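{- Let $P$ be the transition matrix of a reversible and ergodic Markov chain on $V$ with stationary distribution $\pi$ and mixing rate $t^*$. For the SRT router model for $P$, with any initial configuration, $$\left|\chi^{(T)}_w-\mu^{(T)}_w\right|\le\frac{6\pi_w}{\pi_{\min}}\,t^*\,\Delta$$ for all $w\in V$ and all $T\ge0$.
   Context: Let $V=\{1,\dots,N\}$ and let $P\in\mathbb{R}_{\ge 0}^{N\times N}$ be an ergodic (irreducible, aperiodic) stochastic matrix (entries may be irrational) with stationary distribution $\pi$; $\pi_{\min}=\min_v\pi_v$; reversible means $\pi_uP_{u,v}=\pi_vP_{v,u}$ for all $u,v$. For $v\in V$ let $\mathcal N(v)=\{u: P_{v,u}>0\}$, $\delta(v)=|\mathcal N(v)|$, $\Delta=\max_v\delta(v)$. Total variation distance $d_{TV}(\xi,\zeta)=\frac12\|\xi-\zeta\|_1$; mixing time $\tau(\varepsilon)=\max_{v}\min\{t\ge0: d_{TV}(P^t_{v,\cdot},\pi)\le\varepsilon\}$; mixing rate $t^*=\tau(1/4)$. A functional-router model consists of functions $\sigma_v:\mathbb{Z}_{\ge0}\to\mathcal N(v)$; write $I_{v,u}[z,z')=|\{j\in\{z,\dots,z'-1\}:\sigma_v(j)=u\}|$ (zero if $z'\le z$). Given $\chi^{(0)}\in\mathbb{Z}_{\ge0}^N$, set $Z^{(t)}_{v,u}=I_{v,u}\big[\sum_{s=0}^{t-1}\chi^{(s)}_v,\sum_{s=0}^{t}\chi^{(s)}_v\big)$, $\chi^{(t+1)}_u=\sum_vZ^{(t)}_{v,u}$,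 $\mu^{(0)}=\chi^{(0)}$, $\mu^{(t)}=\mu^{(0)}P^t$. The SRT router is defined recursively: for $i\ge0$ let $T_i(v)=\{u\in\mathcal N(v): I_{v,u}[0,i)-(i+1)P_{v,u}<0\}$ and let $\sigma_v(i)$ be an element $u\in T_i(v)$ minimizing $(I_{v,u}[0,i)+1)/P_{v,u}$ (ties broken arbitrarily). -}

module Defs where

open import Level using (Level; _⊔_) renaming (suc to lsuc)
open import Algebra.Bundles using (CommutativeRing)
open import Algebra.Structures using (IsCommutativeRing)
import Algebra.Construct.NaturalChoice.Max as Max
import Algebra.Definitions.RawMonoid as RawMonoidDefs
import Algebra.Properties.CommutativeMonoid.Sum as Sum
open import Data.Bool.Base using (if_then_else_)
open import Data.Fin.Base using (Fin; zero)
import Data.Fin.Properties as Fin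
open import Data.List.Base
  using (List; length; filter; allFin; applyUpTo; tabulate)
import Data.List.Extrema as Extrema
import Data.List.Extrema.Nat as ℕ-Extrema
open import Data.Nat.Base as ℕ using (ℕ; zero; suc)
open import Data.Nat.Divisibility using (_∣_)
import Data.Nat.Properties as ℕ
open import Data.Product.Base using (∃; ∃-syntax; _×_)
open import Relation.Binary.Bundles using (DecTotalOrder; StrictTotalOrder)
open import Relation.Binary.Core using (Rel)
open import Relation.Binary.PropositionalEquality.Core using (_≡_)
open import Relation.Binary.Structures using (IsDecTotalOrder)
open import Relation.Nullary.Decidable.Core using (does)
open import Relation.Nullary.Negation.Core using (¬_)
import Relation.Binary.Properties.DecTotalOrder as DecTotalOrderProperties

-- The real numbers, up to isomorphism: a Dedekind-complete ordered field.
-- The reals meant are the classical ones, so order and equality are decidable.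
-- Inversion is total; its value at 0# is unspecified.
record CompleteOrderedField (c ℓ₁ ℓ₂ : Level) : Set (lsuc (c ⊔ ℓ₁ ⊔ ℓ₂)) where
  infix  8 -_
  infixl 7 _*_ _/_
  infixl 6 _+_
  infix  4 _≈_ _≤_
  field
    Carrier           : Set c
    _≈_               : Rel Carrier ℓ₁
    _≤_               : Rel Carrier ℓ₂
    _+_ _*_           : Carrier → Carrier → Carrier
    -_ _⁻¹            : Carrier → Carrier
    0# 1#             : Carrier
    isCommutativeRing : IsCommutativeRing _≈_ _+_ _*_ -_ 0# 1#
    0≉1               : ¬ (0# ≈ 1#)
    ⁻¹-cong           : ∀ {x y} → x ≈ y → x ⁻¹ ≈ y ⁻¹
    ⁻¹-inverseʳ       : ∀ x → ¬ (x ≈ 0#) → x * x ⁻¹ ≈ 1#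
    isDecTotalOrder   : IsDecTotalOrder _≈_ _≤_
    +-monoˡ-≤         : ∀ {x y} z → x ≤ y → x + z ≤ y + z
    *-nonNegative     : ∀ {x y} → 0# ≤ x → 0# ≤ y → 0# ≤ x * y
    supremum          : (S : Carrier → Set (c ⊔ ℓ₁ ⊔ ℓ₂)) →
                        ∃ S →
                        (∃[ b ] (∀ x → S x → x ≤ b)) →
                        ∃[ s ] (∀ x → S x → x ≤ s) ×
                               (∀ b → (∀ x → S x → x ≤ b) → s ≤ b)

  commutativeRing : CommutativeRing c ℓ₁
  commutativeRing = record { isCommutativeRing = isCommutativeRing }

  decTotalOrder : DecTotalOrder c ℓ₁ ℓ₂
  decTotalOrder = record { isDecTotalOrder = isDecTotalOrder }

  open CommutativeRing commutativeRing public
    using (_-_; +-commutativeMonoid; +-rawMonoid)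
  open DecTotalOrder decTotalOrder public using (totalOrder)
  open DecTotalOrderProperties decTotalOrder public
    using (_<_; <-strictTotalOrder)
  open StrictTotalOrder <-strictTotalOrder public using (_<?_)

  _/_ : Carrier → Carrier → Carrier
  x / y = x * y ⁻¹

  fromℕ : ℕ → Carrier
  fromℕ k = RawMonoidDefs._×_ +-rawMonoid k 1#

  ∣_∣ : Carrier → Carrier
  ∣ x ∣ = Max._⊔_ totalOrder x (- x)

  open Sum +-commutativeMonoid public using (sum)

IsLeast : ∀ {ℓ} → (ℕ → Set ℓ) → ℕ → Set ℓ
IsLeast Q m = Q m × (∀ k → Q k → m ℕ.≤ k)

maximumℕ : ∀ {n} → (Fin n → ℕ) → ℕ
maximumℕ f = ℕ-Extrema.max 0 (tabulate f)

sumℕ : ∀ {n} → (Fin n → ℕ) → ℕ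
sumℕ = Sum.sum ℕ.+-0-commutativeMonoid

interval : ℕ → ℕ → List ℕ
interval z z′ = applyUpTo (z ℕ.+_) (z′ ℕ.∸ z)

module Chains {c ℓ₁ ℓ₂ : Level} (ℝ : CompleteOrderedField c ℓ₁ ℓ₂) where
  open CompleteOrderedField ℝ

  Vector : ℕ → Set c
  Vector N = Fin N → Carrier

  Matrix : ℕ → Set c
  Matrix N = Fin N → Fin N → Carrier

  identity : ∀ {N} → Matrix N
  identity u v = if does (u Fin.≟ v) then 1# else 0#

  infixl 7 _⊗_ _⊙_
  infixr 8 _^_

  _⊗_ : ∀ {N} → Matrix N → Matrix N → Matrix N
  (A ⊗ B) u v = sum λ x → A u x * B x v

  _⊙_ : ∀ {N} → Vector N → Matrix N → Vector N
  (ξ ⊙ A) v = sum λ u → ξ u * A u v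

  _^_ : ∀ {N} → Matrix N → ℕ → Matrix N
  A ^ zero  = identity
  A ^ suc t = (A ^ t) ⊗ A

  IsDistribution : ∀ {N} → Vector N → Set (ℓ₁ ⊔ ℓ₂)
  IsDistribution ξ = (∀ v → 0# ≤ ξ v) × sum ξ ≈ 1#

  IsStochastic : ∀ {N} → Matrix N → Set (ℓ₁ ⊔ ℓ₂)
  IsStochastic P = ∀ v → IsDistribution (P v)

  IsIrreducible : ∀ {N} → Matrix N → Set (ℓ₁ ⊔ ℓ₂)
  IsIrreducible P = ∀ u v → ∃[ t ] 0 ℕ.< t × 0# < (P ^ t) u v

  -- gcd { t ≥ 1 : (P ^ t) v v > 0 } = 1: every common divisor of the
  -- return times is 1.
  IsAperiodic : ∀ {N} → Matrix N → Set (ℓ₁ ⊔ ℓ₂)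
  IsAperiodic P = ∀ v d →
    (∀ t → 0 ℕ.< t → 0# < (P ^ t) v v → d ∣ t) → d ≡ 1

  record IsErgodic {N} (P : Matrix N) : Set (ℓ₁ ⊔ ℓ₂) where
    field
      stochastic  : IsStochastic P
      irreducible : IsIrreducible P
      aperiodic   : IsAperiodic P

  record IsStationary {N} (P : Matrix N) (π : Vector N) : Set (ℓ₁ ⊔ ℓ₂) where
    field
      distribution : IsDistribution π
      invariant    : ∀ v → (π ⊙ P) v ≈ π v

  IsReversible : ∀ {N} → Matrix N → Vector N → Set ℓ₁
  IsReversible P π = ∀ u v → π u * P u v ≈ π v * P v u

  minimum : ∀ {n} → Vector (suc n) → Carrier
  minimum ξ = Extrema.min totalOrder (ξ zero) (tabulate ξ)

  neighbours : ∀ {N} → Matrix N → Fin N → List (Fin N)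
  neighbours P v = filter (λ u → 0# <? P v u) (allFin _)

  δ : ∀ {N} → Matrix N → Fin N → ℕ
  δ P v = length (neighbours P v)

  maxDegree : ∀ {N} → Matrix N → ℕ
  maxDegree P = maximumℕ (δ P)

  dTV : ∀ {N} → Vector N → Vector N → Carrier
  dTV ξ ζ = 1# / fromℕ 2 * sum (λ v → ∣ ξ v - ζ v ∣)

  -- t = max_v min { s : dTV (P^s v) π ≤ ε }. A relation, since the minima
  -- exist only by convergence of the chain.
  IsMixingTime : ∀ {N} → Matrix N → Vector N → Carrier → ℕ → Set ℓ₂
  IsMixingTime {N} P π ε t = ∃[ τ ]
    (∀ (v : Fin N) → IsLeast (λ s → dTV ((P ^ s) v) π ≤ ε) (τ v)) ×
    t ≡ maximumℕ τ

  IsMixingRate : ∀ {N} → Matrix N → Vector N → ℕ → Set ℓ₂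
  IsMixingRate P π = IsMixingTime P π (1# / fromℕ 4)

  μ : ∀ {N} → Matrix N → (Fin N → ℕ) → ℕ → Vector N
  μ P χ₀ t = (λ v → fromℕ (χ₀ v)) ⊙ (P ^ t)

  -- The constraint σ v i ∈ 𝒩(v) on a router is not built into the type.
  Router : ℕ → Set
  Router N = Fin N → ℕ → Fin N

  -- I σ v u z z′ counts the j in [z, z′) with σ v j = u.
  I : ∀ {N} → Router N → Fin N → Fin N → ℕ → ℕ → ℕ
  I σ v u z z′ = length (filter (λ j → σ v j Fin.≟ u) (interval z z′))

  IsFunctionalRouter : ∀ {N} → Matrix N → Router N → Set (ℓ₁ ⊔ ℓ₂)
  IsFunctionalRouter P σ = ∀ v i → 0# < P v (σ v i)

  -- χ is the token configuration, χ-sum t v = Σ_{s<t} χ s v, and Z t v u is the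
  -- number of tokens moving from v to u at time t; the summand χ-sum t v + χ t v
  -- in Z is χ-sum (suc t) v, unfolded for termination.
  module _ {N} (σ : Router N) (χ₀ : Fin N → ℕ) where
    χ     : ℕ → Fin N → ℕ
    χ-sum : ℕ → Fin N → ℕ
    Z     : ℕ → Fin N → Fin N → ℕ

    χ zero    u = χ₀ u
    χ (suc t) u = sumℕ λ v → Z t v u

    χ-sum zero    v = 0
    χ-sum (suc t) v = χ-sum t v ℕ.+ χ t v

    Z t v u = I σ v u (χ-sum t v) (χ-sum t v ℕ.+ χ t v)

  -- u ∈ T_i(v)
  InT : ∀ {N} → Matrix N → Router N → Fin N → ℕ → Fin N → Set (ℓ₁ ⊔ ℓ₂)
  InT P σ v i u =
    0# < P v u × fromℕ (I σ v u 0 i) - fromℕ (suc i) * P v u < 0#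

  -- σ is an SRT router for some resolution of the ties.
  record IsSRT {N} (P : Matrix N) (σ : Router N) : Set (ℓ₁ ⊔ ℓ₂) where
    private
      ratio : Fin N → ℕ → Fin N → Carrier
      ratio v i u = fromℕ (I σ v u 0 i ℕ.+ 1) / P v u
    field
      functional : IsFunctionalRouter P σ
      eligible   : ∀ v i → InT P σ v i (σ v i)
      minimizing : ∀ v i u → InT P σ v i u → ratio v i (σ v i) ≤ ratio v i u

{-# OPTIONS --safe #-}
-- The error e_t = χ_t - μ_t satisfies e_{t+1} = e_t P + d_t, where d_t collects
-- the rounding errors Z_{v,u} - χ_v P_{v,u}; so e_T is the sum of the d_t P^k
-- with t + k = T - 1.  Each rounding error is at most 2, since SRT visits u
-- within ±1 of the ideal z P_{v,u} times among the first z; hence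
-- |d_t(u)| ≤ 2Δ, the support of P being symmetric.  As d_t has sum 0,
-- |(d_t P^k)_w| ≤ 2Δ Σ_u |P^k_{u,w} - π_w|, which by reversibility is at most
-- 2Δ (π_w / π_min) ‖P^k_{w,·} - π‖₁.  These norms are at most 2, are at most 1/2
-- from t* on, and halve every t* steps, so that they sum to at most 3 t*.
module Submission where

open import Defs
open import Algebra.Bundles using (CommutativeMonoid; CommutativeRing)
import Algebra.Construct.NaturalChoice.Max as Max
import Algebra.Properties.CommutativeMonoid.Sum as Sum
import Algebra.Properties.Monoid.Mult as MonoidMult
import Algebra.Properties.Ring as RingProperties
import Algebra.Properties.Semiring.Mult as SemiringMult
import Algebra.Properties.Semiring.Sum as SemiringSum
import Algebra.Solver.Ring as RingSolver
open import Algebra.Solver.Ring.AlmostCommutativeRing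
  using (fromCommutativeRing; _-Raw-AlmostCommutative⟶_)
open import Data.Bool.Base using (true; false; if_then_else_)
open import Data.Fin.Base using (Fin; zero; suc; toℕ; punchIn)
import Data.Fin.Properties as Fin
open import Data.Integer.Base as ℤ using (ℤ; -[1+_])
import Data.Integer.Properties as ℤ
open import Data.List.Base
  using ([]; _∷_; _∷ʳ_; _++_; length; filter; applyUpTo; tabulate)
import Data.List.Extrema as Extrema
import Data.List.Extrema.Nat as ℕ-Extrema
open import Data.List.Properties using (applyUpTo-∷ʳ; filter-++; length-++)
import Data.List.Relation.Unary.All.Properties as All
open import Data.Maybe.Base using (Maybe; just; nothing)
open import Data.Nat.Base as ℕ using (ℕ; zero; suc)
import Data.Nat.Properties as ℕ
open import Data.Product.Base using (∃-syntax; _×_; _,_; proj₁; proj₂)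
open import Data.Sum.Base using (inj₁; inj₂)
open import Function.Base using (_∘_)
open import Relation.Binary.Bundles using (DecTotalOrder)
import Relation.Binary.Properties.DecTotalOrder as DecTotalOrderProperties
open import Relation.Binary.PropositionalEquality as ≡ using (_≡_; _≢_)
import Relation.Binary.Reasoning.PartialOrder as ≤-Reasoning
import Relation.Binary.Reasoning.Setoid as ≈-Reasoning
open import Relation.Nullary using (¬_; Dec; does; yes; no; contradiction)
open import Relation.Nullary.Decidable using (dec-true; dec-false)
open Sum ℕ.+-0-commutativeMonoid using (sum-cong-≗)
  renaming (∑-distrib-+ to ∑ℕ-distrib-+; sum-replicate-zero to sumℕ-replicate-zero)

-- The two halves of the ±1 bound differ in nature. Eligibility forbids overvisiting, so the upper
-- half concerns one target at a time. The lower half is not local: a target waits only because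
-- others are served before it, so all targets must be followed at once, against one common
-- deadline.
--
-- The powers P^k tend to the matrix whose rows all equal π and do not decay. Unless the injected
-- errors sum to zero, each could leave a lasting contribution and the bound would grow with T;
-- subtracting π_w is what makes the series summable. The error at w involves column w of P^k,
-- whereas the mixing rate controls rows: passing from one to the other costs the factor π_w /
-- π_min.

-- Ring solver with integer coefficients.

module ℤ-CoefficientSolver {c ℓ} (R : CommutativeRing c ℓ) where
  open CommutativeRing R
  open RingProperties ring using (-‿+-comm; -0#≈0#; -‿involutive; -‿distribˡ-*; -‿distribʳ-*)
  open MonoidMult +-monoid using (×-homo-+) renaming (_×_ to _·_)
  open SemiringMult semiring using (×1-homo-*)
  open ≈-Reasoning setoid

  -- Equality of integer coefficients is settled by computation. For the reals, `⟦ ℤ.+ n ⟧` unfolds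
  -- to `fromℕ n`, so `con (ℤ.+ 2)` matches `fromℕ 2`. But `con (ℤ.+ 1)` is `1# + 0#` rather than
  -- `1#`, which is why `1#` is passed to `solve` as a variable.
  ⟦_⟧ : ℤ → Carrier
  ⟦ ℤ.+ n ⟧    = n · 1#
  ⟦ -[1+ n ] ⟧ = - (suc n · 1#)

  ⟦⊖⟧ : ∀ m n → ⟦ m ℤ.⊖ n ⟧ ≈ m · 1# - n · 1#
  ⟦⊖⟧ m       zero    = sym (trans (+-congˡ -0#≈0#) (+-identityʳ _))
  ⟦⊖⟧ zero    (suc n) = sym (+-identityˡ _)
  ⟦⊖⟧ (suc m) (suc n) = begin
    ⟦ suc m ℤ.⊖ suc n ⟧               ≡⟨ ≡.cong ⟦_⟧ (ℤ.[1+m]⊖[1+n]≡m⊖n m n) ⟩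
    ⟦ m ℤ.⊖ n ⟧                       ≈⟨ ⟦⊖⟧ m n ⟩
    m · 1# - n · 1#                   ≈⟨ +-congʳ (+-identityʳ _) ⟨
    m · 1# + 0# - n · 1#              ≈⟨ +-congʳ (+-congˡ (-‿inverseʳ 1#)) ⟨
    m · 1# + (1# - 1#) - n · 1#       ≈⟨ +-congʳ (+-assoc _ _ _) ⟨
    m · 1# + 1# - 1# - n · 1#         ≈⟨ +-assoc _ _ _ ⟩
    m · 1# + 1# + (- 1# - n · 1#)     ≈⟨ +-cong (+-comm _ _) (-‿+-comm _ _) ⟩
    1# + m · 1# - (1# + n · 1#)       ∎

  ⟦-⟧ : ∀ i → ⟦ ℤ.- i ⟧ ≈ - ⟦ i ⟧
  ⟦-⟧ (ℤ.+ zero)  = sym -0#≈0#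
  ⟦-⟧ (ℤ.+ suc n) = refl
  ⟦-⟧ -[1+ n ]    = sym (-‿involutive _)

  ⟦+⟧ : ∀ i j → ⟦ i ℤ.+ j ⟧ ≈ ⟦ i ⟧ + ⟦ j ⟧
  ⟦+⟧ (ℤ.+ m)  (ℤ.+ n)  = ×-homo-+ 1# m n
  ⟦+⟧ (ℤ.+ m)  -[1+ n ] = ⟦⊖⟧ m (suc n)
  ⟦+⟧ -[1+ m ] (ℤ.+ n)  = trans (⟦⊖⟧ n (suc m)) (+-comm _ _)
  ⟦+⟧ -[1+ m ] -[1+ n ] = begin
    - (suc (suc (m ℕ.+ n)) · 1#)        ≡⟨ ≡.cong (λ k → - (suc k · 1#)) (ℕ.+-suc m n) ⟨
    - ((suc m ℕ.+ suc n) · 1#)          ≈⟨ -‿cong (×-homo-+ 1# (suc m) (suc n)) ⟩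
    - (suc m · 1# + suc n · 1#)         ≈⟨ -‿+-comm _ _ ⟨
    - (suc m · 1#) - suc n · 1#         ∎

  ⟦+*⟧ : ∀ m j → ⟦ ℤ.+ m ℤ.* j ⟧ ≈ m · 1# * ⟦ j ⟧
  ⟦+*⟧ m (ℤ.+ n) = begin
    ⟦ ℤ.+ m ℤ.* ℤ.+ n ⟧  ≡⟨ ≡.cong ⟦_⟧ (ℤ.pos-* m n) ⟨
    (m ℕ.* n) · 1#       ≈⟨ ×1-homo-* m n ⟩
    m · 1# * n · 1#      ∎
  ⟦+*⟧ m -[1+ n ] = begin
    ⟦ ℤ.+ m ℤ.* -[1+ n ] ⟧          ≡⟨ ≡.cong ⟦_⟧ (ℤ.neg-distribʳ-* (ℤ.+ m) (ℤ.+ suc n)) ⟨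
    ⟦ ℤ.- (ℤ.+ m ℤ.* ℤ.+ suc n) ⟧   ≈⟨ ⟦-⟧ (ℤ.+ m ℤ.* ℤ.+ suc n) ⟩
    - ⟦ ℤ.+ m ℤ.* ℤ.+ suc n ⟧       ≈⟨ -‿cong (⟦+*⟧ m (ℤ.+ suc n)) ⟩
    - (m · 1# * suc n · 1#)         ≈⟨ -‿distribʳ-* _ _ ⟩
    m · 1# * - (suc n · 1#)         ∎

  ⟦*⟧ : ∀ i j → ⟦ i ℤ.* j ⟧ ≈ ⟦ i ⟧ * ⟦ j ⟧
  ⟦*⟧ (ℤ.+ m)  j = ⟦+*⟧ m j
  ⟦*⟧ -[1+ m ] j = begin
    ⟦ -[1+ m ] ℤ.* j ⟧          ≡⟨ ≡.cong ⟦_⟧ (ℤ.neg-distribˡ-* (ℤ.+ suc m) j) ⟨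
    ⟦ ℤ.- (ℤ.+ suc m ℤ.* j) ⟧   ≈⟨ ⟦-⟧ (ℤ.+ suc m ℤ.* j) ⟩
    - ⟦ ℤ.+ suc m ℤ.* j ⟧       ≈⟨ -‿cong (⟦+*⟧ (suc m) j) ⟩
    - (suc m · 1# * ⟦ j ⟧)      ≈⟨ -‿distribˡ-* _ _ ⟩
    - (suc m · 1#) * ⟦ j ⟧      ∎

  homomorphism : ℤ.+-*-rawRing -Raw-AlmostCommutative⟶ fromCommutativeRing R
  homomorphism = record
    { ⟦_⟧    = ⟦_⟧
    ; +-homo = ⟦+⟧
    ; *-homo = ⟦*⟧
    ; -‿homo = ⟦-⟧
    ; 0-homo = refl
    ; 1-homo = +-identityʳ 1#
    }

  ⟦⟧-weaklyDec : ∀ i j → Maybe (⟦ i ⟧ ≈ ⟦ j ⟧)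
  ⟦⟧-weaklyDec i j with i ℤ.≟ j
  ... | yes i≡j = just (reflexive (≡.cong ⟦_⟧ i≡j))
  ... | no _    = nothing

  open RingSolver ℤ.+-*-rawRing (fromCommutativeRing R) homomorphism ⟦⟧-weaklyDec public
    using (solve; con; _:=_; _:+_; _:*_; _:-_; :-_)

-- Stated over any commutative monoid, as it serves both the counts in ℕ and the sums in the field.
sum-single : ∀ {c ℓ} (M : CommutativeMonoid c ℓ) →
  let open CommutativeMonoid M; open Sum M in
  ∀ {n} (i : Fin n) f → (∀ j → j ≢ i → f j ≈ ε) → sum f ≈ f i
sum-single M {suc n} i f f≈0 = begin
  sum f                          ≈⟨ sum-remove f ⟩
  f i ∙ sum (f ∘ punchIn i)  ≈⟨ ∙-congˡ (sum-cong-≋ λ j → f≈0 _ (Fin.punchInᵢ≢i i j)) ⟩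
  f i ∙ sum {n} (λ _ → ε)        ≈⟨ ∙-congˡ (sum-replicate-zero n) ⟩
  f i ∙ ε                        ≈⟨ identityʳ _ ⟩
  f i                            ∎
  where
  open CommutativeMonoid M
  open Sum M
  open ≈-Reasoning setoid

-- Arithmetic, absolute values and finite sums in an ordered field.

module FieldProperties {c ℓ₁ ℓ₂} (ℝ : CompleteOrderedField c ℓ₁ ℓ₂) where
  open CompleteOrderedField ℝ
  open CommutativeRing commutativeRing public
    using ( refl; sym; trans; setoid; reflexive; +-cong; +-congˡ; +-congʳ
          ; *-congˡ; *-congʳ; -‿cong; zeroˡ; zeroʳ; *-identityˡ; *-identityʳ
          ; +-identityˡ; +-identityʳ; +-comm; *-comm; *-assoc; +-assoc )
  open CommutativeRing commutativeRing using (semiring; +-monoid)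
  open DecTotalOrder decTotalOrder public
    using (poset; total; antisym; _≤?_)
    renaming (refl to ≤-refl; reflexive to ≤-reflexive; trans to ≤-trans)
  open DecTotalOrderProperties decTotalOrder public using (≰⇒>; ≮⇒≥; <⇒≱)
  open MonoidMult +-monoid using (×-homo-+)
  open SemiringSum semiring public
    using (sum-cong-≋; sum-replicate-zero; ∑-distrib-+; ∑-comm; *-distribˡ-sum; *-distribʳ-sum)
  open ℤ-CoefficientSolver commutativeRing public
    using (solve; con; _:=_; _:+_; _:*_; _:-_; :-_)
  open ≤-Reasoning poset

  x≤y⇒0≤y-x : ∀ {x y} → x ≤ y → 0# ≤ y - x
  x≤y⇒0≤y-x {x} {y} x≤y = begin
    0#     ≈⟨ solve 1 (λ x → con (ℤ.+ 0) := x :- x) refl x ⟩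
    x - x  ≤⟨ +-monoˡ-≤ (- x) x≤y ⟩
    y - x  ∎

  0≤y-x⇒x≤y : ∀ {x y} → 0# ≤ y - x → x ≤ y
  0≤y-x⇒x≤y {x} {y} 0≤y-x = begin
    x          ≈⟨ +-identityˡ x ⟨
    0# + x     ≤⟨ +-monoˡ-≤ x 0≤y-x ⟩
    y - x + x  ≈⟨ solve 2 (λ x y → y :- x :+ x := y) refl x y ⟩
    y          ∎

  +-monoʳ-≤ : ∀ {x y} z → x ≤ y → z + x ≤ z + y
  +-monoʳ-≤ {x} {y} z x≤y = begin
    z + x  ≈⟨ +-comm z x ⟩
    x + z  ≤⟨ +-monoˡ-≤ z x≤y ⟩
    y + z  ≈⟨ +-comm y z ⟩
    z + y  ∎

  +-mono-≤ : ∀ {x y u v} → x ≤ y → u ≤ v → x + u ≤ y + v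
  +-mono-≤ {y = y} {u} x≤y u≤v = ≤-trans (+-monoˡ-≤ u x≤y) (+-monoʳ-≤ y u≤v)

  +-cancelʳ-≤ : ∀ {x y} z → x + z ≤ y + z → x ≤ y
  +-cancelʳ-≤ {x} {y} z x+z≤y+z = begin
    x          ≈⟨ solve 2 (λ x z → x := x :+ z :- z) refl x z ⟩
    x + z - z  ≤⟨ +-monoˡ-≤ (- z) x+z≤y+z ⟩
    y + z - z  ≈⟨ solve 2 (λ y z → y :+ z :- z := y) refl y z ⟩
    y          ∎

  +-nonNegative : ∀ {x y} → 0# ≤ x → 0# ≤ y → 0# ≤ x + y
  +-nonNegative 0≤x 0≤y = ≤-trans (≤-reflexive (sym (+-identityˡ 0#))) (+-mono-≤ 0≤x 0≤y)

  neg-mono-≤ : ∀ {x y} → x ≤ y → - y ≤ - x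
  neg-mono-≤ {x} {y} x≤y = 0≤y-x⇒x≤y (≤-trans (x≤y⇒0≤y-x x≤y)
    (≤-reflexive (solve 2 (λ x y → y :- x := :- x :- :- y) refl x y)))

  x≤0⇒0≤-x : ∀ {x} → x ≤ 0# → 0# ≤ - x
  x≤0⇒0≤-x x≤0 = ≤-trans (x≤y⇒0≤y-x x≤0) (≤-reflexive (+-identityˡ _))

  *-monoˡ-≤ : ∀ {x y z} → 0# ≤ z → x ≤ y → z * x ≤ z * y
  *-monoˡ-≤ {x} {y} {z} 0≤z x≤y = 0≤y-x⇒x≤y (begin
    0#             ≤⟨ *-nonNegative 0≤z (x≤y⇒0≤y-x x≤y) ⟩
    z * (y - x)    ≈⟨ solve 3 (λ x y z → z :* (y :- x) := z :* y :- z :* x) refl x y z ⟩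
    z * y - z * x  ∎)

  *-monoʳ-≤ : ∀ {x y z} → 0# ≤ z → x ≤ y → x * z ≤ y * z
  *-monoʳ-≤ {x} {y} {z} 0≤z x≤y = begin
    x * z  ≈⟨ *-comm x z ⟩
    z * x  ≤⟨ *-monoˡ-≤ 0≤z x≤y ⟩
    z * y  ≈⟨ *-comm z y ⟩
    y * z  ∎

  0≤1 : 0# ≤ 1#
  0≤1 with total 0# 1#
  ... | inj₁ 0≤1 = 0≤1
  ... | inj₂ 1≤0 = begin
    0#           ≤⟨ *-nonNegative (x≤0⇒0≤-x 1≤0) (x≤0⇒0≤-x 1≤0) ⟩
    - 1# * - 1#  ≈⟨ solve 1 (λ x → (:- x) :* (:- x) := x :* x) refl 1# ⟩
    1# * 1#      ≈⟨ *-identityˡ 1# ⟩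
    1#           ∎

  1≰0 : ¬ (1# ≤ 0#)
  1≰0 1≤0 = 0≉1 (antisym 0≤1 1≤0)

  0<x⇒x≉0 : ∀ {x} → 0# < x → ¬ (x ≈ 0#)
  0<x⇒x≉0 (_ , 0≉x) x≈0 = 0≉x (sym x≈0)

  ⁻¹-nonNegative : ∀ {x} → 0# < x → 0# ≤ x ⁻¹
  ⁻¹-nonNegative {x} 0<x with total 0# (x ⁻¹)
  ... | inj₁ 0≤x⁻¹ = 0≤x⁻¹
  ... | inj₂ x⁻¹≤0 = contradiction (begin
    1#        ≈⟨ ⁻¹-inverseʳ x (0<x⇒x≉0 0<x) ⟨
    x * x ⁻¹  ≤⟨ *-monoˡ-≤ (proj₁ 0<x) x⁻¹≤0 ⟩
    x * 0#    ≈⟨ zeroʳ x ⟩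
    0#        ∎) 1≰0

  x*y/x≈y : ∀ {x} y → 0# < x → x ⁻¹ * (x * y) ≈ y
  x*y/x≈y {x} y 0<x = begin-equality
    x ⁻¹ * (x * y)  ≈⟨ solve 3 (λ x y z → z :* (x :* y) := x :* z :* y) refl x y (x ⁻¹) ⟩
    x * x ⁻¹ * y    ≈⟨ *-congʳ (⁻¹-inverseʳ x (0<x⇒x≉0 0<x)) ⟩
    1# * y          ≈⟨ *-identityˡ y ⟩
    y               ∎

  *-cancelˡ-≤ : ∀ {x y z} → 0# < z → z * x ≤ z * y → x ≤ y
  *-cancelˡ-≤ {x} {y} {z} 0<z zx≤zy = begin
    x               ≈⟨ x*y/x≈y x 0<z ⟨
    z ⁻¹ * (z * x)  ≤⟨ *-monoˡ-≤ (⁻¹-nonNegative 0<z) zx≤zy ⟩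
    z ⁻¹ * (z * y)  ≈⟨ x*y/x≈y y 0<z ⟩
    y               ∎

  x/y≤z⇒x≤z*y : ∀ {x y z} → 0# < y → x / y ≤ z → x ≤ z * y
  x/y≤z⇒x≤z*y {x} {y} {z} 0<y x/y≤z = begin
    x               ≈⟨ x*y/x≈y x 0<y ⟨
    y ⁻¹ * (y * x)  ≈⟨ solve 3 (λ x y y⁻¹ → y⁻¹ :* (y :* x) := x :* y⁻¹ :* y) refl x y (y ⁻¹) ⟩
    x / y * y       ≤⟨ *-monoʳ-≤ (proj₁ 0<y) x/y≤z ⟩
    z * y           ∎

  x≤z*y⇒x/y≤z : ∀ {x y z} → 0# < y → x ≤ z * y → x / y ≤ z
  x≤z*y⇒x/y≤z {x} {y} {z} 0<y x≤zy = begin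
    x / y           ≤⟨ *-monoʳ-≤ (⁻¹-nonNegative 0<y) x≤zy ⟩
    z * y * y ⁻¹    ≈⟨ solve 3 (λ y z y⁻¹ → z :* y :* y⁻¹ := y⁻¹ :* (y :* z)) refl y z (y ⁻¹) ⟩
    y ⁻¹ * (y * z)  ≈⟨ x*y/x≈y z 0<y ⟩
    z               ∎

  fromℕ-+ : ∀ m n → fromℕ (m ℕ.+ n) ≈ fromℕ m + fromℕ n
  fromℕ-+ = ×-homo-+ 1#

  fromℕ-nonNegative : ∀ n → 0# ≤ fromℕ n
  fromℕ-nonNegative zero    = ≤-refl
  fromℕ-nonNegative (suc n) = +-nonNegative 0≤1 (fromℕ-nonNegative n)

  fromℕ-mono-≤ : ∀ {m n} → m ℕ.≤ n → fromℕ m ≤ fromℕ n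
  fromℕ-mono-≤ {n = n} ℕ.z≤n = fromℕ-nonNegative n
  fromℕ-mono-≤ (ℕ.s≤s m≤n)   = +-monoʳ-≤ 1# (fromℕ-mono-≤ m≤n)

  0<fromℕ-suc : ∀ n → 0# < fromℕ (suc n)
  0<fromℕ-suc n = ≰⇒> λ 1+n≤0 → 1≰0 (begin
    1#             ≈⟨ +-identityʳ 1# ⟨
    1# + 0#        ≤⟨ +-monoʳ-≤ 1# (fromℕ-nonNegative n) ⟩
    fromℕ (suc n)  ≤⟨ 1+n≤0 ⟩
    0#             ∎)

  fromℕ-cancel-≤0 : ∀ n → fromℕ n ≤ 0# → n ≡ 0
  fromℕ-cancel-≤0 zero    _      = ≡.refl
  fromℕ-cancel-≤0 (suc n) 1+n≤0  = contradiction 1+n≤0 (<⇒≱ (0<fromℕ-suc n))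

  fromℕ-∸ : ∀ {m n} → m ℕ.≤ n → fromℕ (n ℕ.∸ m) ≈ fromℕ n - fromℕ m
  fromℕ-∸ {m} {n} m≤n = begin-equality
    fromℕ (n ℕ.∸ m)                      ≈⟨ solve 2 (λ x y → x := x :+ y :- y) refl _ _ ⟩
    fromℕ (n ℕ.∸ m) + fromℕ m - fromℕ m  ≈⟨ +-congʳ (fromℕ-+ (n ℕ.∸ m) m) ⟨
    fromℕ (n ℕ.∸ m ℕ.+ m) - fromℕ m      ≡⟨ ≡.cong (λ k → fromℕ k - fromℕ m) (ℕ.m∸n+n≡m m≤n) ⟩
    fromℕ n - fromℕ m                    ∎

  -- A bound `K` known in advance turns the floor into a downward search over naturals, each step
  -- settled by the decidable order.
  bounded-floor : ∀ K {x} → 0# ≤ x → x ≤ fromℕ K → ∃[ m ] fromℕ m ≤ x × x < fromℕ (suc m)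
  bounded-floor K {x} 0≤x x≤K with fromℕ K ≤? x
  ... | yes K≤x = K , K≤x , ≰⇒> λ 1+K≤x → 1≰0 (+-cancelʳ-≤ (fromℕ K) (begin
    1# + fromℕ K  ≤⟨ 1+K≤x ⟩
    x             ≤⟨ x≤K ⟩
    fromℕ K       ≈⟨ +-identityˡ _ ⟨
    0# + fromℕ K  ∎))
  bounded-floor zero    0≤x x≤0   | no 0≰x = contradiction 0≤x 0≰x
  bounded-floor (suc K) {x} 0≤x x≤1+K | no 1+K≰x with x ≤? fromℕ K
  ... | yes x≤K = bounded-floor K 0≤x x≤K
  ... | no  x≰K = K , proj₁ (≰⇒> x≰K) , ≰⇒> 1+K≰x

  open Max totalOrder using (x≤x⊔y; x≤y⊔x; ⊔-lub; ⊔-cong)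

  x≤∣x∣ : ∀ x → x ≤ ∣ x ∣
  x≤∣x∣ x = x≤x⊔y x (- x)

  -x≤∣x∣ : ∀ x → - x ≤ ∣ x ∣
  -x≤∣x∣ x = x≤y⊔x x (- x)

  ∣x∣≤y : ∀ {x y} → x ≤ y → - x ≤ y → ∣ x ∣ ≤ y
  ∣x∣≤y {x} = ⊔-lub {y = x} {z = - x}

  ∣∣-nonNegative : ∀ x → 0# ≤ ∣ x ∣
  ∣∣-nonNegative x with total 0# x
  ... | inj₁ 0≤x = ≤-trans 0≤x (x≤∣x∣ x)
  ... | inj₂ x≤0 = ≤-trans (x≤0⇒0≤-x x≤0) (-x≤∣x∣ x)

  ∣∣-cong : ∀ {x y} → x ≈ y → ∣ x ∣ ≈ ∣ y ∣
  ∣∣-cong x≈y = ⊔-cong x≈y (-‿cong x≈y)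

  0≤x⇒∣x∣≈x : ∀ {x} → 0# ≤ x → ∣ x ∣ ≈ x
  0≤x⇒∣x∣≈x {x} 0≤x = antisym (∣x∣≤y ≤-refl -x≤x) (x≤∣x∣ x)
    where
    -x≤x : - x ≤ x
    -x≤x = begin
      - x   ≤⟨ neg-mono-≤ 0≤x ⟩
      - 0#  ≈⟨ solve 0 (:- con (ℤ.+ 0) := con (ℤ.+ 0)) refl ⟩
      0#    ≤⟨ 0≤x ⟩
      x     ∎

  ∣x+y∣≤∣x∣+∣y∣ : ∀ x y → ∣ x + y ∣ ≤ ∣ x ∣ + ∣ y ∣
  ∣x+y∣≤∣x∣+∣y∣ x y = ∣x∣≤y (+-mono-≤ (x≤∣x∣ x) (x≤∣x∣ y)) (begin
    - (x + y)      ≈⟨ solve 2 (λ x y → :- (x :+ y) := (:- x) :+ (:- y)) refl x y ⟩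
    - x + - y      ≤⟨ +-mono-≤ (-x≤∣x∣ x) (-x≤∣x∣ y) ⟩
    ∣ x ∣ + ∣ y ∣  ∎)

  ∣-x∣≈∣x∣ : ∀ x → ∣ - x ∣ ≈ ∣ x ∣
  ∣-x∣≈∣x∣ x = antisym
    (∣x∣≤y (-x≤∣x∣ x) (≤-trans (≤-reflexive (solve 1 (λ x → :- (:- x) := x) refl x)) (x≤∣x∣ x)))
    (∣x∣≤y (≤-trans (≤-reflexive (solve 1 (λ x → x := :- (:- x)) refl x)) (-x≤∣x∣ (- x))) (x≤∣x∣ (- x)))

  ∣x-y∣≤∣x∣+∣y∣ : ∀ x y → ∣ x - y ∣ ≤ ∣ x ∣ + ∣ y ∣
  ∣x-y∣≤∣x∣+∣y∣ x y = ≤-trans (∣x+y∣≤∣x∣+∣y∣ x (- y)) (≤-reflexive (+-congˡ (∣-x∣≈∣x∣ y)))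

  ∣x*y∣≈x*∣y∣ : ∀ {x} → 0# ≤ x → ∀ y → ∣ x * y ∣ ≈ x * ∣ y ∣
  ∣x*y∣≈x*∣y∣ {x} 0≤x y with total 0# y
  ... | inj₁ 0≤y = trans (0≤x⇒∣x∣≈x (*-nonNegative 0≤x 0≤y)) (*-congˡ (sym (0≤x⇒∣x∣≈x 0≤y)))
  ... | inj₂ y≤0 = begin-equality
    ∣ x * y ∣      ≈⟨ ∣-x∣≈∣x∣ (x * y) ⟨
    ∣ - (x * y) ∣  ≈⟨ ∣∣-cong (solve 2 (λ x y → :- (x :* y) := x :* (:- y)) refl x y) ⟩
    ∣ x * - y ∣    ≈⟨ 0≤x⇒∣x∣≈x (*-nonNegative 0≤x (x≤0⇒0≤-x y≤0)) ⟩
    x * - y        ≈⟨ *-congˡ (0≤x⇒∣x∣≈x (x≤0⇒0≤-x y≤0)) ⟨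
    x * ∣ - y ∣    ≈⟨ *-congˡ (∣-x∣≈∣x∣ y) ⟩
    x * ∣ y ∣      ∎

  ∣x*y∣≤∣x∣*∣y∣ : ∀ x y → ∣ x * y ∣ ≤ ∣ x ∣ * ∣ y ∣
  ∣x*y∣≤∣x∣*∣y∣ x y with total 0# x
  ... | inj₁ 0≤x = begin
    ∣ x * y ∣      ≈⟨ ∣x*y∣≈x*∣y∣ 0≤x y ⟩
    x * ∣ y ∣      ≤⟨ *-monoʳ-≤ (∣∣-nonNegative y) (x≤∣x∣ x) ⟩
    ∣ x ∣ * ∣ y ∣  ∎
  ... | inj₂ x≤0 = begin
    ∣ x * y ∣      ≈⟨ ∣∣-cong (solve 2 (λ x y → x :* y := (:- x) :* (:- y)) refl x y) ⟩
    ∣ - x * - y ∣  ≈⟨ ∣x*y∣≈x*∣y∣ (x≤0⇒0≤-x x≤0) (- y) ⟩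
    - x * ∣ - y ∣  ≈⟨ *-congˡ (∣-x∣≈∣x∣ y) ⟩
    - x * ∣ y ∣    ≤⟨ *-monoʳ-≤ (∣∣-nonNegative y) (-x≤∣x∣ x) ⟩
    ∣ x ∣ * ∣ y ∣  ∎

  sum-mono-≤ : ∀ {n} {f g : Fin n → Carrier} → (∀ i → f i ≤ g i) → sum f ≤ sum g
  sum-mono-≤ {zero}  f≤g = ≤-refl
  sum-mono-≤ {suc n} f≤g = +-mono-≤ (f≤g zero) (sum-mono-≤ (f≤g ∘ suc))

  sum-nonNegative : ∀ {n} {f : Fin n → Carrier} → (∀ i → 0# ≤ f i) → 0# ≤ sum f
  sum-nonNegative {zero}  0≤f = ≤-refl
  sum-nonNegative {suc n} 0≤f = +-nonNegative (0≤f zero) (sum-nonNegative (0≤f ∘ suc))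

  term≤sum : ∀ {n} {f : Fin n → Carrier} → (∀ i → 0# ≤ f i) → ∀ i → f i ≤ sum f
  term≤sum {f = f} 0≤f zero = begin
    f zero                  ≈⟨ +-identityʳ _ ⟨
    f zero + 0#             ≤⟨ +-monoʳ-≤ _ (sum-nonNegative (0≤f ∘ suc)) ⟩
    f zero + sum (f ∘ suc)  ∎
  term≤sum {f = f} 0≤f (suc i) = begin
    f (suc i)               ≤⟨ term≤sum (0≤f ∘ suc) i ⟩
    sum (f ∘ suc)           ≈⟨ +-identityˡ _ ⟨
    0# + sum (f ∘ suc)      ≤⟨ +-monoˡ-≤ _ (0≤f zero) ⟩
    f zero + sum (f ∘ suc)  ∎

  ∣sum∣≤sum-∣∣ : ∀ {n} (f : Fin n → Carrier) → ∣ sum f ∣ ≤ sum (λ i → ∣ f i ∣)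
  ∣sum∣≤sum-∣∣ {zero}  f = ≤-reflexive (0≤x⇒∣x∣≈x ≤-refl)
  ∣sum∣≤sum-∣∣ {suc n} f =
    ≤-trans (∣x+y∣≤∣x∣+∣y∣ _ _) (+-monoʳ-≤ _ (∣sum∣≤sum-∣∣ (f ∘ suc)))

  sum-neg : ∀ {n} (f : Fin n → Carrier) → sum (λ i → - f i) ≈ - sum f
  sum-neg {zero}  f = solve 0 (con (ℤ.+ 0) := :- con (ℤ.+ 0)) refl
  sum-neg {suc n} f = trans (+-congˡ (sum-neg (f ∘ suc)))
    (solve 2 (λ x y → (:- x) :+ (:- y) := :- (x :+ y)) refl _ _)

  sum-distrib-- : ∀ {n} (f g : Fin n → Carrier) → sum (λ i → f i - g i) ≈ sum f - sum g
  sum-distrib-- f g = trans (∑-distrib-+ f (λ i → - g i)) (+-congˡ (sum-neg g))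

  fromℕ-sum : ∀ {n} (f : Fin n → ℕ) → fromℕ (sumℕ f) ≈ sum (fromℕ ∘ f)
  fromℕ-sum {zero}  f = refl
  fromℕ-sum {suc n} f = trans (fromℕ-+ (f zero) _) (+-congˡ (fromℕ-sum (f ∘ suc)))

-- Counting the visits of a router.

indicator : ∀ {p} {Q : Set p} → Dec Q → ℕ
indicator Q? = if does Q? then 1 else 0

indicator-yes : ∀ {p} {Q : Set p} (Q? : Dec Q) → Q → indicator Q? ≡ 1
indicator-yes Q? q rewrite dec-true Q? q = ≡.refl

indicator-no : ∀ {p} {Q : Set p} (Q? : Dec Q) → ¬ Q → indicator Q? ≡ 0
indicator-no Q? ¬q rewrite dec-false Q? ¬q = ≡.refl

length-filter-∷ : ∀ {a p} {A : Set a} {Q : A → Set p} (Q? : ∀ x → Dec (Q x)) x xs →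
  length (filter Q? (x ∷ xs)) ≡ indicator (Q? x) ℕ.+ length (filter Q? xs)
length-filter-∷ Q? x xs with does (Q? x)
... | true  = ≡.refl
... | false = ≡.refl

length-filter-tabulate : ∀ {a p} {A : Set a} {Q : A → Set p} (Q? : ∀ x → Dec (Q x)) →
  ∀ {n} (f : Fin n → A) → length (filter Q? (tabulate f)) ≡ sumℕ (λ i → indicator (Q? (f i)))
length-filter-tabulate Q? {zero}  f = ≡.refl
length-filter-tabulate Q? {suc n} f = ≡.trans (length-filter-∷ Q? (f zero) _)
  (≡.cong (indicator (Q? (f zero)) ℕ.+_) (length-filter-tabulate Q? (f ∘ suc)))

module RouterCounts {c ℓ₁ ℓ₂} (ℝ : CompleteOrderedField c ℓ₁ ℓ₂) {N} (σ : Chains.Router ℝ N) (v : Fin N) where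
  open Chains ℝ using (I)
  open ≡.≡-Reasoning

  hit : Fin N → ℕ → ℕ
  hit u j = indicator (σ v j Fin.≟ u)

  I-empty : ∀ u z → I σ v u z z ≡ 0
  I-empty u z rewrite ℕ.n∸n≡0 z = ≡.refl

  I-suc : ∀ u z k → I σ v u z (z ℕ.+ suc k) ≡ I σ v u z (z ℕ.+ k) ℕ.+ hit u (z ℕ.+ k)
  I-suc u z k rewrite ℕ.m+n∸m≡n z (suc k) | ℕ.m+n∸m≡n z k = begin
    length (filter hit? (applyUpTo (z ℕ.+_) (suc k)))
      ≡⟨ ≡.cong (length ∘ filter hit?) (applyUpTo-∷ʳ (z ℕ.+_) k) ⟨
    length (filter hit? (applyUpTo (z ℕ.+_) k ∷ʳ (z ℕ.+ k)))
      ≡⟨ ≡.cong length (filter-++ hit? (applyUpTo (z ℕ.+_) k) _) ⟩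
    length (filter hit? (applyUpTo (z ℕ.+_) k) ++ filter hit? (z ℕ.+ k ∷ []))
      ≡⟨ length-++ (filter hit? (applyUpTo (z ℕ.+_) k)) ⟩
    length (filter hit? (applyUpTo (z ℕ.+_) k)) ℕ.+ length (filter hit? (z ℕ.+ k ∷ []))
      ≡⟨ ≡.cong (length (filter hit? (applyUpTo (z ℕ.+_) k)) ℕ.+_)
           (≡.trans (length-filter-∷ hit? (z ℕ.+ k) []) (ℕ.+-identityʳ _)) ⟩
    length (filter hit? (applyUpTo (z ℕ.+_) k)) ℕ.+ hit u (z ℕ.+ k)  ∎
    where
    hit? : ∀ j → Dec (σ v j ≡ u)
    hit? j = σ v j Fin.≟ u

  I-split : ∀ u z k → I σ v u 0 (z ℕ.+ k) ≡ I σ v u 0 z ℕ.+ I σ v u z (z ℕ.+ k)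
  I-split u z zero rewrite ℕ.+-identityʳ z | I-empty u z = ≡.sym (ℕ.+-identityʳ _)
  I-split u z (suc k) = begin
    I σ v u 0 (z ℕ.+ suc k)                                      ≡⟨ ≡.cong (I σ v u 0) (ℕ.+-suc z k) ⟩
    I σ v u 0 (suc (z ℕ.+ k))                                    ≡⟨ I-suc u 0 (z ℕ.+ k) ⟩
    I σ v u 0 (z ℕ.+ k) ℕ.+ hit u (z ℕ.+ k)                      ≡⟨ ≡.cong (ℕ._+ hit u (z ℕ.+ k)) (I-split u z k) ⟩
    I σ v u 0 z ℕ.+ I σ v u z (z ℕ.+ k) ℕ.+ hit u (z ℕ.+ k)      ≡⟨ ℕ.+-assoc (I σ v u 0 z) _ _ ⟩
    I σ v u 0 z ℕ.+ (I σ v u z (z ℕ.+ k) ℕ.+ hit u (z ℕ.+ k))    ≡⟨ ≡.cong (I σ v u 0 z ℕ.+_) (I-suc u z k) ⟨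
    I σ v u 0 z ℕ.+ I σ v u z (z ℕ.+ suc k)                      ∎

  sum-hit : ∀ j → sumℕ (λ u → hit u j) ≡ 1
  sum-hit j = ≡.trans
    (sum-single ℕ.+-0-commutativeMonoid (σ v j) _ λ u u≢ → indicator-no (σ v j Fin.≟ u) (u≢ ∘ ≡.sym))
    (indicator-yes (σ v j Fin.≟ σ v j) ≡.refl)

  -- Each firing has exactly one target; conservation of tokens rests on this.
  sum-I : ∀ z k → sumℕ (λ u → I σ v u z (z ℕ.+ k)) ≡ k
  sum-I z zero rewrite ℕ.+-identityʳ z =
    ≡.trans (sum-cong-≗ (λ u → I-empty u z)) (sumℕ-replicate-zero N)
  sum-I z (suc k) = begin
    sumℕ (λ u → I σ v u z (z ℕ.+ suc k))                            ≡⟨ sum-cong-≗ (λ u → I-suc u z k) ⟩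
    sumℕ (λ u → I σ v u z (z ℕ.+ k) ℕ.+ hit u (z ℕ.+ k))            ≡⟨ ∑ℕ-distrib-+ (λ u → I σ v u z (z ℕ.+ k)) _ ⟩
    sumℕ (λ u → I σ v u z (z ℕ.+ k)) ℕ.+ sumℕ (λ u → hit u (z ℕ.+ k)) ≡⟨ ≡.cong₂ ℕ._+_ (sum-I z k) (sum-hit (z ℕ.+ k)) ⟩
    k ℕ.+ 1                                                         ≡⟨ ℕ.+-comm k 1 ⟩
    suc k                                                           ∎

  I-never : ∀ u → (∀ j → σ v j ≢ u) → ∀ z k → I σ v u z (z ℕ.+ k) ≡ 0
  I-never u never z zero rewrite ℕ.+-identityʳ z = I-empty u z
  I-never u never z (suc k) = ≡.trans (I-suc u z k)
    (≡.cong₂ ℕ._+_ (I-never u never z k) (indicator-no (σ v (z ℕ.+ k) Fin.≟ u) (never (z ℕ.+ k))))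

-- Discrepancy of the SRT router at a single vertex.

-- The router is read as an earliest-deadline-first schedule: the k-th visit to
-- u is a job with deadline k / P v u, and u ∈ T_i(v) says that the next such job
-- is released.  Of the jobs of u, quota u = ⌊ D P v u ⌋ have deadline at most D;
-- the invariant is that at most max(0, D - z) of them, over all u, are
-- unfinished at time z.
module SRTDiscrepancy {c ℓ₁ ℓ₂} (ℝ : CompleteOrderedField c ℓ₁ ℓ₂) {N} (P : Chains.Matrix ℝ N)
  (stochastic : Chains.IsStochastic ℝ P)
  (σ : Chains.Router ℝ N) (srt : Chains.IsSRT ℝ P σ) (v : Fin N) where
  open CompleteOrderedField ℝ
  open Chains ℝ using (I; InT; module IsSRT)
  open FieldProperties ℝ
  open RouterCounts ℝ σ v
  open IsSRT srt
  open ≤-Reasoning poset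

  private
    p : Fin N → Carrier
    p = P v

    0≤p : ∀ u → 0# ≤ p u
    0≤p = proj₁ (stochastic v)

    count : ℕ → Fin N → ℕ
    count z u = I σ v u 0 z

  count-hit : ∀ z → count (suc z) (σ v z) ≡ suc (count z (σ v z))
  count-hit z = ≡.trans (I-suc (σ v z) 0 z)
    (≡.trans (≡.cong (count z (σ v z) ℕ.+_) (indicator-yes (σ v z Fin.≟ σ v z) ≡.refl)) (ℕ.+-comm _ 1))

  count-miss : ∀ z u → σ v z ≢ u → count (suc z) u ≡ count z u
  count-miss z u miss = ≡.trans (I-suc u 0 z)
    (≡.trans (≡.cong (count z u ℕ.+_) (indicator-no (σ v z Fin.≟ u) miss)) (ℕ.+-identityʳ _))

  count-mono : ∀ z u → count z u ℕ.≤ count (suc z) u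
  count-mono z u = ≡.subst (count z u ℕ.≤_) (≡.sym (I-suc u 0 z)) (ℕ.m≤m+n _ _)

  -- A target chosen at step `z` has a count below (z+1) p by eligibility, and the visit adds one.
  -- At all other steps the count stays and the right side grows.
  count≤zp+1 : ∀ z u → fromℕ (count z u) ≤ fromℕ z * p u + 1#
  count≤zp+1 zero u = begin
    0#               ≤⟨ 0≤1 ⟩
    1#               ≈⟨ solve 2 (λ x y → y := con (ℤ.+ 0) :* x :+ y) refl (p u) 1# ⟩
    0# * p u + 1#    ∎
  count≤zp+1 (suc z) u with σ v z Fin.≟ u
  ... | yes ≡.refl = begin
    fromℕ (count (suc z) u)        ≡⟨ ≡.cong fromℕ (count-hit z) ⟩
    1# + fromℕ (count z u)         ≈⟨ +-comm _ _ ⟩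
    fromℕ (count z u) + 1#         ≤⟨ +-monoˡ-≤ 1# (0≤y-x⇒x≤y (≤-trans (x≤0⇒0≤-x (proj₁ (proj₂ (eligible v z))))
                                        (≤-reflexive (solve 2 (λ x y → :- (x :- y) := y :- x) refl _ _)))) ⟩
    fromℕ (suc z) * p u + 1#       ∎
  ... | no miss = begin
    fromℕ (count (suc z) u)        ≡⟨ ≡.cong fromℕ (count-miss z u miss) ⟩
    fromℕ (count z u)              ≤⟨ count≤zp+1 z u ⟩
    fromℕ z * p u + 1#             ≤⟨ +-monoˡ-≤ 1# (*-monoʳ-≤ (0≤p u) (fromℕ-mono-≤ (ℕ.n≤1+n z))) ⟩
    fromℕ (suc z) * p u + 1#       ∎

  module _ (D : Carrier) (quota : Fin N → ℕ)
    (quota≤ : ∀ u → fromℕ (quota u) ≤ D * p u)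
    (quota> : ∀ u → D * p u < fromℕ (suc (quota u))) where

    -- Jobs with deadline at most `D` not yet served at time `z`, whether or not `D` has passed.
    -- Truncated subtraction is essential: a target ahead of its quota counts as 0 and cannot offset
    -- the lateness of another.
    overdue : ℕ → Fin N → ℕ
    overdue z u = quota u ℕ.∸ count z u

    -- By `early` the visited target is still below its quota, so its truncated difference really
    -- falls by one; no other count changes.
    overdue-hit : ∀ z → count z (σ v z) ℕ.< quota (σ v z) →
      sumℕ (overdue z) ≡ suc (sumℕ (overdue (suc z)))
    overdue-hit z early = ≡.trans (sum-cong-≗ split)
      (≡.trans (∑ℕ-distrib-+ (λ u → hit u z) _) (≡.cong (ℕ._+ sumℕ (overdue (suc z))) (sum-hit z)))
      where
      split : ∀ u → overdue z u ≡ hit u z ℕ.+ overdue (suc z) u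
      split u with σ v z Fin.≟ u
      ... | yes ≡.refl rewrite count-hit z = ℕ.+-∸-assoc 1 early
      ... | no miss = ≡.cong (quota u ℕ.∸_) (≡.sym (count-miss z u miss))

    -- By `late` the job served at `z` has deadline beyond `D`. The router takes the earliest
    -- deadline among eligible targets, so a target `u` with an unserved job due by `D` cannot be
    -- eligible. Its count is therefore at least (z+1) p, which leaves at most D p - (z+1) p of its
    -- quota.
    overdue≤slack : ∀ z B → 0# ≤ B → D ≤ fromℕ (suc z) + B → quota (σ v z) ℕ.≤ count z (σ v z) →
      ∀ u → fromℕ (overdue (suc z) u) ≤ B * p u
    overdue≤slack z B 0≤B D≤1+z+B late u with quota u ℕ.≤? count z u
    ... | yes m≤c rewrite ℕ.m≤n⇒m∸n≡0 (ℕ.≤-trans m≤c (count-mono z u)) = *-nonNegative 0≤B (0≤p u)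
    ... | no  m≰c = begin
      fromℕ (quota u ℕ.∸ count (suc z) u)            ≤⟨ fromℕ-mono-≤ (ℕ.∸-monoʳ-≤ (quota u) (count-mono z u)) ⟩
      fromℕ (quota u ℕ.∸ count z u)                  ≈⟨ fromℕ-∸ (ℕ.<⇒≤ c<m) ⟩
      fromℕ (quota u) - fromℕ (count z u)            ≤⟨ +-mono-≤ (quota≤ u) (neg-mono-≤ served) ⟩
      D * p u - fromℕ (suc z) * p u                  ≤⟨ +-monoˡ-≤ _ (*-monoʳ-≤ (0≤p u) D≤1+z+B) ⟩
      (fromℕ (suc z) + B) * p u - fromℕ (suc z) * p u ≈⟨ solve 3 (λ z B p → (z :+ B) :* p :- z :* p := B :* p) refl _ B (p u) ⟩
      B * p u                                        ∎
      where
      c<m : count z u ℕ.< quota u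
      c<m = ℕ.≰⇒> m≰c

      c+1≤Dp : fromℕ (count z u ℕ.+ 1) ≤ D * p u
      c+1≤Dp = ≤-trans (fromℕ-mono-≤ (≡.subst (ℕ._≤ quota u) (ℕ.+-comm 1 _) c<m)) (quota≤ u)

      0<p : 0# < p u
      0<p = 0≤p u , λ 0≈p → contradiction (begin
        fromℕ (suc (count z u))    ≡⟨ ≡.cong fromℕ (ℕ.+-comm 1 (count z u)) ⟩
        fromℕ (count z u ℕ.+ 1)    ≤⟨ c+1≤Dp ⟩
        D * p u                    ≈⟨ *-congˡ 0≈p ⟨
        D * 0#                     ≈⟨ zeroʳ D ⟩
        0#                         ∎) (<⇒≱ (0<fromℕ-suc (count z u)))

      not-eligible : ¬ InT P σ v z u
      not-eligible u∈T = <⇒≱ (quota> (σ v z)) (begin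
        fromℕ (suc (quota (σ v z)))           ≤⟨ fromℕ-mono-≤ (ℕ.s≤s late) ⟩
        fromℕ (suc (count z (σ v z)))         ≡⟨ ≡.cong fromℕ (ℕ.+-comm 1 (count z (σ v z))) ⟩
        fromℕ (count z (σ v z) ℕ.+ 1)         ≤⟨ x/y≤z⇒x≤z*y (functional v z)
                                                   (≤-trans (minimizing v z u u∈T) (x≤z*y⇒x/y≤z 0<p c+1≤Dp)) ⟩
        D * p (σ v z)                         ∎)

      served : fromℕ (suc z) * p u ≤ fromℕ (count z u)
      served = 0≤y-x⇒x≤y (≮⇒≥ λ c-zp<0 → not-eligible (0<p , c-zp<0))

    -- The slack `B` is a free bound on max(0, D - z), so the induction can be invoked one step
    -- earlier with `B + 1#`. An early visit pays for that extra unit. After a late one the past is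
    -- irrelevant: the targets owe at most `B * p u` each, and `p` sums to 1.
    total-overdue≤slack : 0# ≤ D → ∀ z B → 0# ≤ B → D ≤ fromℕ z + B → fromℕ (sumℕ (overdue z)) ≤ B
    total-overdue≤slack 0≤D zero B 0≤B D≤B = begin
      fromℕ (sumℕ quota)       ≈⟨ fromℕ-sum quota ⟩
      sum (fromℕ ∘ quota)      ≤⟨ sum-mono-≤ quota≤ ⟩
      sum (λ u → D * p u)      ≈⟨ *-distribˡ-sum D p ⟨
      D * sum p                ≈⟨ *-congˡ (proj₂ (stochastic v)) ⟩
      D * 1#                   ≈⟨ *-identityʳ D ⟩
      D                        ≤⟨ D≤B ⟩
      0# + B                   ≈⟨ +-identityˡ B ⟩
      B                        ∎
    total-overdue≤slack 0≤D (suc z) B 0≤B D≤1+z+B with ℕ.<-≤-connex (count z (σ v z)) (quota (σ v z))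
    ... | inj₁ early = +-cancelʳ-≤ 1# (begin
      fromℕ (sumℕ (overdue (suc z))) + 1#       ≈⟨ +-comm _ _ ⟩
      fromℕ (suc (sumℕ (overdue (suc z))))      ≡⟨ ≡.cong fromℕ (overdue-hit z early) ⟨
      fromℕ (sumℕ (overdue z))                  ≤⟨ total-overdue≤slack 0≤D z (B + 1#) (+-nonNegative 0≤B 0≤1)
                                                     (≤-trans D≤1+z+B (≤-reflexive
                                                       (solve 3 (λ o z B → o :+ z :+ B := z :+ (B :+ o)) refl 1# (fromℕ z) B))) ⟩
      B + 1#                                    ∎)
    ... | inj₂ late = begin
      fromℕ (sumℕ (overdue (suc z)))       ≈⟨ fromℕ-sum (overdue (suc z)) ⟩
      sum (fromℕ ∘ overdue (suc z))        ≤⟨ sum-mono-≤ (overdue≤slack z B 0≤B D≤1+z+B late) ⟩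
      sum (λ u → B * p u)                  ≈⟨ *-distribˡ-sum B p ⟨
      B * sum p                            ≈⟨ *-congˡ (proj₂ (stochastic v)) ⟩
      B * 1#                               ≈⟨ *-identityʳ B ⟩
      B                                    ∎

  -- The invariant at D = z with slack 0: at time `z` every target has filled its quota, the floor
  -- of z p.
  zp≤count+1 : ∀ z u → fromℕ z * p u ≤ fromℕ (count z u) + 1#
  zp≤count+1 z u = begin
    fromℕ z * p u                 ≤⟨ proj₁ (quota> u) ⟩
    fromℕ (suc (quota u))         ≤⟨ fromℕ-mono-≤ (ℕ.s≤s quota≤count) ⟩
    fromℕ (suc (count z u))       ≈⟨ +-comm _ _ ⟩
    fromℕ (count z u) + 1#        ∎
    where
    0≤D : 0# ≤ fromℕ z
    0≤D = fromℕ-nonNegative z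

    p≤1 : ∀ x → p x ≤ 1#
    p≤1 x = ≤-trans (term≤sum 0≤p x) (≤-reflexive (proj₂ (stochastic v)))

    floor : ∀ x → ∃[ m ] fromℕ m ≤ fromℕ z * p x × fromℕ z * p x < fromℕ (suc m)
    floor x = bounded-floor z (*-nonNegative 0≤D (0≤p x))
      (≤-trans (*-monoˡ-≤ 0≤D (p≤1 x)) (≤-reflexive (*-identityʳ _)))

    quota : Fin N → ℕ
    quota x = proj₁ (floor x)

    quota≤ : ∀ x → fromℕ (quota x) ≤ fromℕ z * p x
    quota≤ x = proj₁ (proj₂ (floor x))

    quota> : ∀ x → fromℕ z * p x < fromℕ (suc (quota x))
    quota> x = proj₂ (proj₂ (floor x))

    quota≤count : quota u ℕ.≤ count z u
    quota≤count = ℕ.m∸n≡0⇒m≤n (fromℕ-cancel-≤0 _ (begin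
      fromℕ (overdue _ quota quota≤ quota> z u)           ≤⟨ term≤sum (λ x → fromℕ-nonNegative (quota x ℕ.∸ count z x)) u ⟩
      sum (λ x → fromℕ (quota x ℕ.∸ count z x))           ≈⟨ fromℕ-sum (λ x → quota x ℕ.∸ count z x) ⟨
      fromℕ (sumℕ (λ x → quota x ℕ.∸ count z x))          ≤⟨ total-overdue≤slack (fromℕ z) quota quota≤ quota> 0≤D z 0# ≤-refl
                                                               (≤-reflexive (sym (+-identityʳ _))) ⟩
      0#                                                  ∎))

  discrepancy : ∀ u z → ∣ fromℕ (count z u) - fromℕ z * p u ∣ ≤ 1#
  discrepancy u z = ∣x∣≤y
    (0≤y-x⇒x≤y (≤-trans (x≤y⇒0≤y-x (count≤zp+1 z u))
      (≤-reflexive (solve 3 (λ x y o → y :+ o :- x := o :- (x :- y)) refl _ _ 1#))))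
    (0≤y-x⇒x≤y (≤-trans (x≤y⇒0≤y-x (zp≤count+1 z u))
      (≤-reflexive (solve 3 (λ x y o → x :+ o :- y := o :- :- (x :- y)) refl _ _ 1#))))

  -- A window is the difference of two prefixes, each off by at most 1. The bound 2 is thus
  -- independent of the position and length of the window.
  interval-discrepancy : ∀ u z k → ∣ fromℕ (I σ v u z (z ℕ.+ k)) - fromℕ k * p u ∣ ≤ fromℕ 2
  interval-discrepancy u z k = begin
    ∣ fromℕ i - fromℕ k * p u ∣                      ≈⟨ ∣∣-cong regroup ⟩
    ∣ d (z ℕ.+ k) - d z ∣                            ≤⟨ ∣x-y∣≤∣x∣+∣y∣ _ _ ⟩
    ∣ d (z ℕ.+ k) ∣ + ∣ d z ∣                        ≤⟨ +-mono-≤ (discrepancy u (z ℕ.+ k)) (discrepancy u z) ⟩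
    1# + 1#                                          ≈⟨ +-congˡ (+-identityʳ 1#) ⟨
    fromℕ 2                                          ∎
    where
    i : ℕ
    i = I σ v u z (z ℕ.+ k)

    d : ℕ → Carrier
    d j = fromℕ (count j u) - fromℕ j * p u

    regroup : fromℕ i - fromℕ k * p u ≈ d (z ℕ.+ k) - d z
    regroup = begin-equality
      fromℕ i - fromℕ k * p u
        ≈⟨ solve 5 (λ i k p c z → i :- k :* p := c :+ i :- (z :+ k) :* p :- (c :- z :* p)) refl _ _ _ (fromℕ (count z u)) (fromℕ z) ⟩
      fromℕ (count z u) + fromℕ i - (fromℕ z + fromℕ k) * p u - d z
        ≈⟨ +-congʳ (+-cong (fromℕ-+ (count z u) i) (-‿cong (*-congʳ (fromℕ-+ z k)))) ⟨
      fromℕ (count z u ℕ.+ i) - fromℕ (z ℕ.+ k) * p u - d z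
        ≡⟨ ≡.cong (λ m → fromℕ m - fromℕ (z ℕ.+ k) * p u - d z) (I-split u z k) ⟨
      d (z ℕ.+ k) - d z
        ∎

-- Row vectors, matrix powers and the ℓ¹ norm.

module MatrixProperties {c ℓ₁ ℓ₂} (ℝ : CompleteOrderedField c ℓ₁ ℓ₂) {N : ℕ} where
  open CompleteOrderedField ℝ
  open Chains ℝ
  open FieldProperties ℝ
  open ≤-Reasoning poset

  norm : Vector N → Carrier
  norm ξ = sum λ v → ∣ ξ v ∣

  ⊙-congˡ : ∀ {ξ ζ : Vector N} (A : Matrix N) → (∀ v → ξ v ≈ ζ v) → ∀ v → (ξ ⊙ A) v ≈ (ζ ⊙ A) v
  ⊙-congˡ A ξ≈ζ v = sum-cong-≋ λ u → *-congʳ (ξ≈ζ u)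

  ⊙-distrib-+ : ∀ (ξ ζ : Vector N) (A : Matrix N) v → ((λ u → ξ u + ζ u) ⊙ A) v ≈ (ξ ⊙ A) v + (ζ ⊙ A) v
  ⊙-distrib-+ ξ ζ A v = trans
    (sum-cong-≋ λ u → solve 3 (λ x y a → (x :+ y) :* a := x :* a :+ y :* a) refl (ξ u) (ζ u) (A u v))
    (∑-distrib-+ (λ u → ξ u * A u v) (λ u → ζ u * A u v))

  ⊙-distrib-- : ∀ (ξ ζ : Vector N) (A : Matrix N) v → ((λ u → ξ u - ζ u) ⊙ A) v ≈ (ξ ⊙ A) v - (ζ ⊙ A) v
  ⊙-distrib-- ξ ζ A v = trans
    (sum-cong-≋ λ u → solve 3 (λ x y a → (x :- y) :* a := x :* a :- y :* a) refl (ξ u) (ζ u) (A u v))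
    (sum-distrib-- (λ u → ξ u * A u v) (λ u → ζ u * A u v))

  ⊙-assoc : ∀ (ξ : Vector N) (A B : Matrix N) v → (ξ ⊙ (A ⊗ B)) v ≈ (ξ ⊙ A ⊙ B) v
  ⊙-assoc ξ A B v = begin-equality
    sum (λ u → ξ u * sum (λ x → A u x * B x v))      ≈⟨ sum-cong-≋ (λ u → *-distribˡ-sum (ξ u) (λ x → A u x * B x v)) ⟩
    sum (λ u → sum (λ x → ξ u * (A u x * B x v)))    ≈⟨ ∑-comm (λ u x → ξ u * (A u x * B x v)) ⟩
    sum (λ x → sum (λ u → ξ u * (A u x * B x v)))    ≈⟨ sum-cong-≋ (λ x → sum-cong-≋ λ u → *-assoc (ξ u) (A u x) (B x v)) ⟨
    sum (λ x → sum (λ u → ξ u * A u x * B x v))      ≈⟨ sum-cong-≋ (λ x → *-distribʳ-sum (B x v) (λ u → ξ u * A u x)) ⟨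
    sum (λ x → sum (λ u → ξ u * A u x) * B x v)      ∎

  identity-diagonal : ∀ (v : Fin N) → identity v v ≈ 1#
  identity-diagonal v rewrite dec-true (v Fin.≟ v) ≡.refl = refl

  identity-off-diagonal : ∀ {u v : Fin N} → u ≢ v → identity u v ≈ 0#
  identity-off-diagonal {u} {v} u≢v rewrite dec-false (u Fin.≟ v) u≢v = refl

  ⊙-identityʳ : ∀ (ξ : Vector N) v → (ξ ⊙ identity) v ≈ ξ v
  ⊙-identityʳ ξ v = begin-equality
    sum (λ u → ξ u * identity u v)   ≈⟨ sum-single +-commutativeMonoid v _ (λ u u≢v →
                                          trans (*-congˡ (identity-off-diagonal u≢v)) (zeroʳ _)) ⟩
    ξ v * identity v v               ≈⟨ *-congˡ (identity-diagonal v) ⟩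
    ξ v * 1#                         ≈⟨ *-identityʳ _ ⟩
    ξ v                              ∎

  ⊙-identityˡ : ∀ (A : Matrix N) u v → (identity u ⊙ A) v ≈ A u v
  ⊙-identityˡ A u v = begin-equality
    sum (λ x → identity u x * A x v)   ≈⟨ sum-single +-commutativeMonoid u _ (λ x x≢u →
                                            trans (*-congʳ (identity-off-diagonal (x≢u ∘ ≡.sym))) (zeroˡ _)) ⟩
    identity u u * A u v               ≈⟨ *-congʳ (identity-diagonal u) ⟩
    1# * A u v                         ≈⟨ *-identityˡ _ ⟩
    A u v                              ∎

  row-^-+ : ∀ (A : Matrix N) m n w v → ((A ^ m) w ⊙ A ^ n) v ≈ (A ^ (n ℕ.+ m)) w v
  row-^-+ A m zero    w v = ⊙-identityʳ ((A ^ m) w) v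
  row-^-+ A m (suc n) w v = trans (⊙-assoc ((A ^ m) w) (A ^ n) A v) (⊙-congˡ A (row-^-+ A m n w) v)

  -- Powers append their new factor on the right, whereas unrolling the error recurrence leaves a
  -- factor `P` to the left of `P ^ k`.
  ⊙-^-suc : ∀ (ξ : Vector N) (A : Matrix N) k v → (ξ ⊙ A ⊙ A ^ k) v ≈ (ξ ⊙ A ^ suc k) v
  ⊙-^-suc ξ A zero v = begin-equality
    (ξ ⊙ A ⊙ identity) v     ≈⟨ ⊙-identityʳ (ξ ⊙ A) v ⟩
    (ξ ⊙ A) v                ≈⟨ ⊙-congˡ A (⊙-identityʳ ξ) v ⟨
    (ξ ⊙ identity ⊙ A) v     ≈⟨ ⊙-assoc ξ identity A v ⟨
    (ξ ⊙ (identity ⊗ A)) v   ∎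
  ⊙-^-suc ξ A (suc k) v = begin-equality
    (ξ ⊙ A ⊙ (A ^ k ⊗ A)) v    ≈⟨ ⊙-assoc (ξ ⊙ A) (A ^ k) A v ⟩
    (ξ ⊙ A ⊙ A ^ k ⊙ A) v      ≈⟨ ⊙-congˡ A (⊙-^-suc ξ A k) v ⟩
    (ξ ⊙ A ^ suc k ⊙ A) v      ≈⟨ ⊙-assoc ξ (A ^ suc k) A v ⟨
    (ξ ⊙ (A ^ suc k ⊗ A)) v    ∎

  ⊗-^-comm : ∀ (A : Matrix N) k u v → (A u ⊙ A ^ k) v ≈ (A ^ suc k) u v
  ⊗-^-comm A k u v = begin-equality
    (A u ⊙ A ^ k) v                 ≈⟨ ⊙-congˡ (A ^ k) (⊙-identityˡ A u) v ⟨
    (identity u ⊙ A ⊙ A ^ k) v      ≈⟨ ⊙-^-suc (identity u) A k v ⟩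
    (identity u ⊙ A ^ suc k) v      ≈⟨ ⊙-identityˡ (A ^ suc k) u v ⟩
    (A ^ suc k) u v                 ∎

  sum-⊙ : ∀ (ξ : Vector N) {A : Matrix N} → (∀ u → sum (A u) ≈ 1#) → sum (ξ ⊙ A) ≈ sum ξ
  sum-⊙ ξ {A} rows = begin-equality
    sum (λ v → sum (λ u → ξ u * A u v))    ≈⟨ ∑-comm (λ v u → ξ u * A u v) ⟩
    sum (λ u → sum (λ v → ξ u * A u v))    ≈⟨ sum-cong-≋ (λ u → *-distribˡ-sum (ξ u) (A u)) ⟨
    sum (λ u → ξ u * sum (A u))            ≈⟨ sum-cong-≋ (λ u → trans (*-congˡ (rows u)) (*-identityʳ _)) ⟩
    sum ξ                                  ∎

  norm-cong : ∀ {ξ ζ : Vector N} → (∀ v → ξ v ≈ ζ v) → norm ξ ≈ norm ζ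
  norm-cong ξ≈ζ = sum-cong-≋ λ v → ∣∣-cong (ξ≈ζ v)

  -- On row vectors the ℓ¹ operator norm is the largest ℓ¹ norm of a row. It is applied with 1 for
  -- stochastic matrices and with 1/2 for a centred power.
  norm-⊙ : ∀ (ξ : Vector N) {A : Matrix N} {a} → (∀ u → norm (A u) ≤ a) → norm (ξ ⊙ A) ≤ a * norm ξ
  norm-⊙ ξ {A} {a} rows = begin
    sum (λ v → ∣ sum (λ u → ξ u * A u v) ∣)          ≤⟨ sum-mono-≤ (λ v → ∣sum∣≤sum-∣∣ (λ u → ξ u * A u v)) ⟩
    sum (λ v → sum (λ u → ∣ ξ u * A u v ∣))          ≤⟨ sum-mono-≤ (λ v → sum-mono-≤ λ u → ∣x*y∣≤∣x∣*∣y∣ (ξ u) (A u v)) ⟩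
    sum (λ v → sum (λ u → ∣ ξ u ∣ * ∣ A u v ∣))      ≈⟨ ∑-comm (λ v u → ∣ ξ u ∣ * ∣ A u v ∣) ⟩
    sum (λ u → sum (λ v → ∣ ξ u ∣ * ∣ A u v ∣))      ≈⟨ sum-cong-≋ (λ u → *-distribˡ-sum ∣ ξ u ∣ (λ v → ∣ A u v ∣)) ⟨
    sum (λ u → ∣ ξ u ∣ * norm (A u))                 ≤⟨ sum-mono-≤ (λ u → *-monoˡ-≤ (∣∣-nonNegative _) (rows u)) ⟩
    sum (λ u → ∣ ξ u ∣ * a)                          ≈⟨ *-distribʳ-sum a (λ u → ∣ ξ u ∣) ⟨
    norm ξ * a                                       ≈⟨ *-comm _ _ ⟩
    a * norm ξ                                       ∎

  norm-distribution : ∀ {ξ : Vector N} → IsDistribution ξ → norm ξ ≈ 1#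
  norm-distribution (0≤ξ , sum≈1) = trans (sum-cong-≋ λ v → 0≤x⇒∣x∣≈x (0≤ξ v)) sum≈1

  ^-stochastic : ∀ {A : Matrix N} → IsStochastic A → ∀ t → IsStochastic (A ^ t)
  ^-stochastic st zero u = nonNegative , (begin-equality
    sum (identity u)   ≈⟨ sum-single +-commutativeMonoid u _ (λ x x≢u → identity-off-diagonal (x≢u ∘ ≡.sym)) ⟩
    identity u u       ≈⟨ identity-diagonal u ⟩
    1#                 ∎)
    where
    nonNegative : ∀ v → 0# ≤ identity u v
    nonNegative v with does (u Fin.≟ v)
    ... | true  = 0≤1
    ... | false = ≤-refl
  ^-stochastic {A} st (suc t) u =
    (λ v → sum-nonNegative λ x → *-nonNegative (proj₁ (^-stochastic st t u) x) (proj₁ (st x) v)) ,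
    trans (sum-⊙ ((A ^ t) u) (λ x → proj₂ (st x))) (proj₂ (^-stochastic st t u))

-- Sums over initial segments of ℕ.

module RangeSums {c ℓ₁ ℓ₂} (ℝ : CompleteOrderedField c ℓ₁ ℓ₂) where
  open CompleteOrderedField ℝ
  open FieldProperties ℝ
  open ≤-Reasoning poset

  ∑< : ℕ → (ℕ → Carrier) → Carrier
  ∑< T f = sum {T} (f ∘ toℕ)

  ∑<-cong : ∀ T {f g : ℕ → Carrier} → (∀ t → f t ≈ g t) → ∑< T f ≈ ∑< T g
  ∑<-cong T f≈g = sum-cong-≋ {T} (f≈g ∘ toℕ)

  ∑<-mono-≤ : ∀ T {f g : ℕ → Carrier} → (∀ t → f t ≤ g t) → ∑< T f ≤ ∑< T g
  ∑<-mono-≤ T f≤g = sum-mono-≤ {T} (f≤g ∘ toℕ)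

  ∑<-* : ∀ T a f → ∑< T (λ t → a * f t) ≈ a * ∑< T f
  ∑<-* T a f = sym (*-distribˡ-sum {T} a (f ∘ toℕ))

  ∑<-split : ∀ S T f → ∑< (S ℕ.+ T) f ≈ ∑< S f + ∑< T (λ t → f (S ℕ.+ t))
  ∑<-split zero    T f = sym (+-identityˡ _)
  ∑<-split (suc S) T f = trans (+-congˡ (∑<-split S T (f ∘ suc))) (sym (+-assoc _ _ _))

  ∑<-const : ∀ T a → ∑< T (λ _ → a) ≈ fromℕ T * a
  ∑<-const zero    a = sym (zeroˡ a)
  ∑<-const (suc T) a = trans (+-congˡ (∑<-const T a)) (trans (+-congʳ (sym (*-identityˡ a)))
    (solve 3 (λ o n a → o :* a :+ n :* a := (o :+ n) :* a) refl 1# (fromℕ T) a))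

  ∑<-extend : ∀ S T {f : ℕ → Carrier} → (∀ t → 0# ≤ f t) → ∑< T f ≤ ∑< (S ℕ.+ T) f
  ∑<-extend S T {f} 0≤f = begin
    ∑< T f                                  ≈⟨ +-identityʳ _ ⟨
    ∑< T f + 0#                             ≤⟨ +-monoʳ-≤ _ (sum-nonNegative {S} (λ i → 0≤f _)) ⟩
    ∑< T f + ∑< S (λ t → f (T ℕ.+ t))       ≈⟨ ∑<-split T S f ⟨
    ∑< (T ℕ.+ S) f                          ≡⟨ ≡.cong (λ k → ∑< k f) (ℕ.+-comm T S) ⟩
    ∑< (S ℕ.+ T) f                          ∎

  -- The tail B T = ∑_{t<T} f (s + t) satisfies 2 B T ≤ s + B T, by halving in steps of s.
  ∑<-halving : ∀ s (f : ℕ → Carrier) → (∀ t → 0# ≤ f t) → (∀ t → f t ≤ fromℕ 2) →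
    (∀ t → fromℕ 2 * f (s ℕ.+ t) ≤ 1#) → (∀ t → fromℕ 2 * f (s ℕ.+ t) ≤ f t) →
    ∀ T → ∑< T f ≤ fromℕ 3 * fromℕ s
  ∑<-halving s f 0≤f f≤2 2f≤1 halving T = begin
    ∑< T f                               ≤⟨ ∑<-extend s T 0≤f ⟩
    ∑< (s ℕ.+ T) f                       ≈⟨ ∑<-split s T f ⟩
    -- The 3 is 2 + 1: the first `s` terms are at most 2 each, and the whole tail adds at most `s`.
    -- The case `s` = 0 is included, since halving then forces `f` to vanish.
    ∑< s f + tail T                      ≤⟨ +-mono-≤ (≤-trans (∑<-mono-≤ s f≤2) (≤-reflexive (∑<-const s _))) tail≤s ⟩
    fromℕ s * fromℕ 2 + fromℕ s          ≈⟨ solve 1 (λ s → s :* con (ℤ.+ 2) :+ s := con (ℤ.+ 3) :* s) refl (fromℕ s) ⟩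
    fromℕ 3 * fromℕ s                    ∎
    where
    tail : ℕ → Carrier
    tail T = ∑< T (λ t → f (s ℕ.+ t))

    tail≤s : tail T ≤ fromℕ s
    tail≤s = +-cancelʳ-≤ (tail T) (begin
      tail T + tail T                  ≈⟨ solve 1 (λ x → x :+ x := con (ℤ.+ 2) :* x) refl (tail T) ⟩
      -- Lengthening the range by `s` first means that `T` terms remain after the shift by `s`, so
      -- the finite tail is compared with itself.
      fromℕ 2 * tail T                 ≤⟨ *-monoˡ-≤ (fromℕ-nonNegative 2) (∑<-extend s T (λ t → 0≤f (s ℕ.+ t))) ⟩
      fromℕ 2 * tail (s ℕ.+ T)         ≈⟨ ∑<-* (s ℕ.+ T) (fromℕ 2) (λ t → f (s ℕ.+ t)) ⟨
      ∑< (s ℕ.+ T) (λ t → fromℕ 2 * f (s ℕ.+ t))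
        ≈⟨ ∑<-split s T (λ t → fromℕ 2 * f (s ℕ.+ t)) ⟩
      ∑< s (λ t → fromℕ 2 * f (s ℕ.+ t)) + ∑< T (λ t → fromℕ 2 * f (s ℕ.+ (s ℕ.+ t)))
        ≤⟨ +-mono-≤ (∑<-mono-≤ s 2f≤1) (∑<-mono-≤ T (λ t → halving (s ℕ.+ t))) ⟩
      ∑< s (λ _ → 1#) + tail T         ≈⟨ +-congʳ (trans (∑<-const s 1#) (*-identityʳ _)) ⟩
      fromℕ s + tail T                 ∎)

-- Stationarity, detailed balance and convergence of the chain.

module ReversibleChain {c ℓ₁ ℓ₂} (ℝ : CompleteOrderedField c ℓ₁ ℓ₂) {n : ℕ}
  (P : Chains.Matrix ℝ (suc n)) (π : Chains.Vector ℝ (suc n))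
  (ergodic : Chains.IsErgodic ℝ P) (stationary : Chains.IsStationary ℝ P π)
  (reversible : Chains.IsReversible ℝ P π) where
  open CompleteOrderedField ℝ
  open Chains ℝ
  open FieldProperties ℝ
  open MatrixProperties ℝ
  open RangeSums ℝ
  open IsErgodic ergodic
  open IsStationary stationary
  open ≤-Reasoning poset

  π-nonNegative : ∀ v → 0# ≤ π v
  π-nonNegative = proj₁ distribution

  π-invariant : ∀ t v → (π ⊙ P ^ t) v ≈ π v
  π-invariant zero    v = ⊙-identityʳ π v
  π-invariant (suc t) v = begin-equality
    (π ⊙ (P ^ t ⊗ P)) v    ≈⟨ ⊙-assoc π (P ^ t) P v ⟩
    (π ⊙ P ^ t ⊙ P) v      ≈⟨ ⊙-congˡ P (π-invariant t) v ⟩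
    (π ⊙ P) v              ≈⟨ invariant v ⟩
    π v                    ∎

  -- If π vanished at `v`, invariance under P^t would make each π_u P^t_{u,v} vanish. Irreducibility
  -- supplies for each `u` a `t` with P^t_{u,v} > 0, so π would be zero everywhere, against its mass
  -- of 1.
  π-positive : ∀ v → 0# < π v
  π-positive v = ≰⇒> λ πv≤0 → 1≰0 (begin
    1#                 ≈⟨ proj₂ distribution ⟨
    sum π              ≤⟨ sum-mono-≤ (vanishes πv≤0) ⟩
    sum {suc n} (λ _ → 0#)     ≈⟨ sum-replicate-zero (suc n) ⟩
    0#                 ∎)
    where
    vanishes : π v ≤ 0# → ∀ u → π u ≤ 0#
    vanishes πv≤0 u with irreducible u v
    ... | t , _ , 0<Pt = *-cancelˡ-≤ 0<Pt (begin
      (P ^ t) u v * π u      ≈⟨ *-comm _ _ ⟩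
      π u * (P ^ t) u v      ≤⟨ term≤sum (λ x → *-nonNegative (π-nonNegative x) (proj₁ (^-stochastic stochastic t x) v)) u ⟩
      (π ⊙ P ^ t) v          ≈⟨ π-invariant t v ⟩
      π v                    ≤⟨ πv≤0 ⟩
      0#                     ≈⟨ zeroʳ _ ⟨
      (P ^ t) u v * 0#       ∎)

  minimum-positive : 0# < minimum π
  minimum-positive = v<min⁺ (π-positive zero) (All.tabulate⁺ π-positive)
    where open Extrema totalOrder

  minimum≤ : ∀ v → minimum π ≤ π v
  minimum≤ v = All.tabulate⁻ {f = π} (min≤xs (π zero) (tabulate π)) v
    where open Extrema totalOrder

  ^-reversible : ∀ t → IsReversible (P ^ t) π
  ^-reversible zero u v with u Fin.≟ v
  ... | yes ≡.refl = *-congˡ (sym (identity-diagonal u))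
  ... | no u≢v     = trans (zeroʳ _) (sym (trans (*-congˡ (identity-off-diagonal (u≢v ∘ ≡.sym))) (zeroʳ _)))
  ^-reversible (suc t) u v = begin-equality
    π u * sum (λ x → (P ^ t) u x * P x v)        ≈⟨ *-distribˡ-sum (π u) (λ x → (P ^ t) u x * P x v) ⟩
    sum (λ x → π u * ((P ^ t) u x * P x v))      ≈⟨ sum-cong-≋ swap ⟩
    sum (λ x → π v * (P v x * (P ^ t) x u))      ≈⟨ *-distribˡ-sum (π v) (λ x → P v x * (P ^ t) x u) ⟨
    π v * (P v ⊙ P ^ t) u                        ≈⟨ *-congˡ (⊗-^-comm P t v u) ⟩
    π v * (P ^ suc t) v u                        ∎
    where
    swap : ∀ x → π u * ((P ^ t) u x * P x v) ≈ π v * (P v x * (P ^ t) x u)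
    swap x = begin-equality
      π u * ((P ^ t) u x * P x v)      ≈⟨ *-assoc _ _ _ ⟨
      π u * (P ^ t) u x * P x v        ≈⟨ *-congʳ (^-reversible t u x) ⟩
      π x * (P ^ t) x u * P x v        ≈⟨ solve 3 (λ a b c → a :* b :* c := a :* c :* b) refl _ _ _ ⟩
      π x * P x v * (P ^ t) x u        ≈⟨ *-congʳ (reversible x v) ⟩
      π v * P v x * (P ^ t) x u        ≈⟨ *-assoc _ _ _ ⟩
      π v * (P v x * (P ^ t) x u)      ∎

  P-symmetric-support : ∀ {u v} → 0# < P u v → 0# < P v u
  P-symmetric-support {u} {v} 0<Puv = ≰⇒> λ Pvu≤0 → contradiction (*-cancelˡ-≤ (π-positive u) (begin
    π u * P u v   ≈⟨ reversible u v ⟩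
    π v * P v u   ≤⟨ *-monoˡ-≤ (π-nonNegative v) Pvu≤0 ⟩
    π v * 0#      ≈⟨ zeroʳ _ ⟩
    0#            ≈⟨ zeroʳ _ ⟨
    π u * 0#      ∎)) (<⇒≱ 0<Puv)

  distance : Fin (suc n) → ℕ → Carrier
  distance w t = norm λ v → (P ^ t) w v - π v

  distance-nonNegative : ∀ w t → 0# ≤ distance w t
  distance-nonNegative w t = sum-nonNegative λ v → ∣∣-nonNegative ((P ^ t) w v - π v)

  distance≤2 : ∀ w t → distance w t ≤ fromℕ 2
  distance≤2 w t = begin
    distance w t                          ≤⟨ sum-mono-≤ (λ v → ∣x-y∣≤∣x∣+∣y∣ ((P ^ t) w v) (π v)) ⟩
    sum (λ v → ∣ (P ^ t) w v ∣ + ∣ π v ∣)  ≈⟨ ∑-distrib-+ (λ v → ∣ (P ^ t) w v ∣) (λ v → ∣ π v ∣) ⟩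
    norm ((P ^ t) w) + norm π             ≈⟨ +-cong (norm-distribution (^-stochastic stochastic t w)) (norm-distribution distribution) ⟩
    1# + 1#                               ≈⟨ +-congˡ (+-identityʳ 1#) ⟨
    fromℕ 2                               ∎

  deviation-step : ∀ w s t v → (P ^ (s ℕ.+ t)) w v - π v ≈ ((λ u → (P ^ t) w u - π u) ⊙ P ^ s) v
  deviation-step w s t v = begin-equality
    (P ^ (s ℕ.+ t)) w v - π v                        ≈⟨ +-cong (row-^-+ P t s w v) (-‿cong (π-invariant s v)) ⟨
    ((P ^ t) w ⊙ P ^ s) v - (π ⊙ P ^ s) v            ≈⟨ ⊙-distrib-- ((P ^ t) w) π (P ^ s) v ⟨
    ((λ u → (P ^ t) w u - π u) ⊙ P ^ s) v            ∎

  -- A mixing time records only the first moment of closeness. Contraction by stochastic matrices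
  -- keeps the distance small from then on, so the individual times may be replaced by their
  -- maximum.
  distance-antitone : ∀ w {s t} → s ℕ.≤ t → distance w t ≤ distance w s
  distance-antitone w {s} {t} s≤t = begin
    distance w t                    ≡⟨ ≡.cong (distance w) (ℕ.m∸n+n≡m s≤t) ⟨
    distance w (t ℕ.∸ s ℕ.+ s)      ≈⟨ norm-cong (deviation-step w (t ℕ.∸ s) s) ⟩
    norm ((λ u → (P ^ s) w u - π u) ⊙ P ^ (t ℕ.∸ s))
                                    ≤⟨ norm-⊙ (λ u → (P ^ s) w u - π u) {P ^ (t ℕ.∸ s)} (λ u → ≤-reflexive
                                         (norm-distribution (^-stochastic stochastic (t ℕ.∸ s) u))) ⟩
    1# * distance w s               ≈⟨ *-identityˡ _ ⟩
    distance w s                    ∎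

  sum-deviation : ∀ w t → sum (λ v → (P ^ t) w v - π v) ≈ 0#
  sum-deviation w t = begin-equality
    sum (λ v → (P ^ t) w v - π v)   ≈⟨ sum-distrib-- ((P ^ t) w) π ⟩
    sum ((P ^ t) w) - sum π         ≈⟨ +-cong (proj₂ (^-stochastic stochastic t w)) (-‿cong (proj₂ distribution)) ⟩
    1# - 1#                         ≈⟨ solve 1 (λ x → x :- x := con (ℤ.+ 0)) refl 1# ⟩
    0#                              ∎

  -- A vector of sum zero does not see a constant subtracted from a column. This serves both the
  -- halving of distances and the bound on injected errors.
  ⊙-centre : ∀ (ξ : Vector (suc n)) → sum ξ ≈ 0# → ∀ (A : Matrix (suc n)) v b →
    (ξ ⊙ A) v ≈ sum (λ u → ξ u * (A u v - b))
  ⊙-centre ξ sum≈0 A v b = sym (begin-equality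
    sum (λ u → ξ u * (A u v - b))           ≈⟨ sum-cong-≋ (λ u → solve 3 (λ x a b → x :* (a :- b) := x :* a :- x :* b) refl (ξ u) (A u v) b) ⟩
    sum (λ u → ξ u * A u v - ξ u * b)       ≈⟨ sum-distrib-- (λ u → ξ u * A u v) (λ u → ξ u * b) ⟩
    (ξ ⊙ A) v - sum (λ u → ξ u * b)         ≈⟨ +-congˡ (-‿cong (*-distribʳ-sum b ξ)) ⟨
    (ξ ⊙ A) v - sum ξ * b                   ≈⟨ +-congˡ (-‿cong (*-congʳ sum≈0)) ⟩
    (ξ ⊙ A) v - 0# * b                      ≈⟨ solve 2 (λ x b → x :- con (ℤ.+ 0) :* b := x) refl _ b ⟩
    (ξ ⊙ A) v                               ∎)

  module _ (t* : ℕ) (mixing : IsMixingRate P π t*) where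

    -- Total variation is half the ℓ¹ norm, so the threshold 1/4 becomes 1/2 for the norm.
    dTV≤¼⇒2x≤1 : ∀ {x} → 1# / fromℕ 2 * x ≤ 1# / fromℕ 4 → fromℕ 2 * x ≤ 1#
    dTV≤¼⇒2x≤1 {x} half = begin
      fromℕ 2 * x                                    ≈⟨ *-congˡ (x*y/x≈y x (0<fromℕ-suc 1)) ⟨
      fromℕ 2 * (fromℕ 2 ⁻¹ * (fromℕ 2 * x))         ≈⟨ solve 2 (λ h x → con (ℤ.+ 2) :* (h :* (con (ℤ.+ 2) :* x)) := con (ℤ.+ 4) :* (con (ℤ.+ 1) :* h :* x)) refl _ x ⟩
      fromℕ 4 * (fromℕ 1 / fromℕ 2 * x)              ≈⟨ *-congˡ (*-congʳ (*-congʳ (+-identityʳ 1#))) ⟩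
      fromℕ 4 * (1# / fromℕ 2 * x)                   ≤⟨ *-monoˡ-≤ (fromℕ-nonNegative 4) half ⟩
      fromℕ 4 * (1# / fromℕ 4)                       ≈⟨ *-congˡ (*-identityˡ _) ⟩
      fromℕ 4 * fromℕ 4 ⁻¹                           ≈⟨ ⁻¹-inverseʳ _ (0<x⇒x≉0 (0<fromℕ-suc 3)) ⟩
      1#                                             ∎

    2*distance≤1 : ∀ w t → fromℕ 2 * distance w (t* ℕ.+ t) ≤ 1#
    2*distance≤1 w t = ≤-trans
      (*-monoˡ-≤ (fromℕ-nonNegative 2) (distance-antitone w (ℕ.≤-trans
        τ≤t* (ℕ.m≤m+n _ t))))
      (dTV≤¼⇒2x≤1 (proj₁ (proj₁ (proj₂ mixing) w)))
      where
      τ : Fin (suc n) → ℕ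
      τ = proj₁ mixing

      τ≤t* : τ w ℕ.≤ t*
      τ≤t* = ≡.subst (τ w ℕ.≤_) (≡.sym (proj₂ (proj₂ mixing)))
        (All.tabulate⁻ {f = τ} (ℕ-Extrema.xs≤max 0 (tabulate τ)) w)

    -- The deviation at time `t` has sum zero, so applying P^t* to it is the same as applying P^t*
    -- with π subtracted from each row. The rows of that matrix have norm at most 1/2.
    distance-halving : ∀ w t → fromℕ 2 * distance w (t* ℕ.+ t) ≤ distance w t
    distance-halving w t = begin
      fromℕ 2 * distance w (t* ℕ.+ t)       ≈⟨ *-congˡ (norm-cong (λ v → trans (deviation-step w t* t v)
                                                 (⊙-centre ξ (sum-deviation w t) (P ^ t*) v (π v)))) ⟩
      fromℕ 2 * norm (ξ ⊙ A)                ≤⟨ *-monoˡ-≤ (fromℕ-nonNegative 2) (norm-⊙ ξ {A} halved) ⟩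
      fromℕ 2 * (fromℕ 2 ⁻¹ * norm ξ)       ≈⟨ *-assoc _ _ _ ⟨
      fromℕ 2 * fromℕ 2 ⁻¹ * norm ξ         ≈⟨ *-congʳ (⁻¹-inverseʳ _ (0<x⇒x≉0 (0<fromℕ-suc 1))) ⟩
      1# * norm ξ                           ≈⟨ *-identityˡ _ ⟩
      distance w t                          ∎
      where
      ξ : Vector (suc n)
      ξ u = (P ^ t) w u - π u

      A : Matrix (suc n)
      A u v = (P ^ t*) u v - π v

      halved : ∀ u → norm (A u) ≤ fromℕ 2 ⁻¹
      halved u = *-cancelˡ-≤ (0<fromℕ-suc 1) (begin
        fromℕ 2 * distance u t*              ≡⟨ ≡.cong (λ k → fromℕ 2 * distance u k) (ℕ.+-identityʳ t*) ⟨
        fromℕ 2 * distance u (t* ℕ.+ 0)      ≤⟨ 2*distance≤1 u 0 ⟩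
        1#                                   ≈⟨ ⁻¹-inverseʳ _ (0<x⇒x≉0 (0<fromℕ-suc 1)) ⟨
        fromℕ 2 * fromℕ 2 ⁻¹                 ∎)

    sum-distance : ∀ w T → ∑< T (distance w) ≤ fromℕ 3 * fromℕ t*
    sum-distance w = ∑<-halving t* (distance w) (distance-nonNegative w) (distance≤2 w)
      (2*distance≤1 w) (distance-halving w)

  -- Detailed balance for P^k gives π_u (P^k_{u,w} - π_w) = π_w (P^k_{w,u} - π_u), the subtracted
  -- products being equal. Bounding π_u below by its minimum makes the factor uniform in `u`.
  reverse-deviation : ∀ w k u → ∣ (P ^ k) u w - π w ∣ ≤ π w / minimum π * ∣ (P ^ k) w u - π u ∣
  reverse-deviation w k u = *-cancelˡ-≤ minimum-positive (begin
    minimum π * ∣ a ∣                             ≤⟨ *-monoʳ-≤ (∣∣-nonNegative a) (minimum≤ u) ⟩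
    π u * ∣ a ∣                                   ≈⟨ ∣x*y∣≈x*∣y∣ (π-nonNegative u) a ⟨
    ∣ π u * a ∣                                   ≈⟨ ∣∣-cong swap ⟩
    ∣ π w * b ∣                                   ≈⟨ ∣x*y∣≈x*∣y∣ (π-nonNegative w) b ⟩
    π w * ∣ b ∣                                   ≈⟨ *-identityˡ _ ⟨
    1# * (π w * ∣ b ∣)                            ≈⟨ *-congʳ (⁻¹-inverseʳ _ (0<x⇒x≉0 minimum-positive)) ⟨
    minimum π * minimum π ⁻¹ * (π w * ∣ b ∣)      ≈⟨ solve 4 (λ m i p b → m :* i :* (p :* b) := m :* (p :* i :* b)) refl _ _ _ _ ⟩
    minimum π * (π w / minimum π * ∣ b ∣)         ∎)
    where
    a b : Carrier
    a = (P ^ k) u w - π w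
    b = (P ^ k) w u - π u

    swap : π u * a ≈ π w * b
    swap = begin-equality
      π u * ((P ^ k) u w - π w)        ≈⟨ solve 3 (λ x p y → x :* (p :- y) := x :* p :- y :* x) refl _ _ _ ⟩
      π u * (P ^ k) u w - π w * π u    ≈⟨ +-congʳ (^-reversible k u w) ⟩
      π w * (P ^ k) w u - π w * π u    ≈⟨ solve 3 (λ x p y → x :* p :- x :* y := x :* (p :- y)) refl _ _ _ ⟩
      π w * ((P ^ k) w u - π u)        ∎

  δ≤maxDegree : ∀ u → δ P u ℕ.≤ maxDegree P
  δ≤maxDegree = All.tabulate⁻ {f = δ P} (ℕ-Extrema.xs≤max 0 (tabulate (δ P)))

  -- Errors reach `u` from its in-neighbours, while `δ` counts out-neighbours.
  δ-in : ∀ u → sumℕ (λ v → indicator (0# <? P v u)) ≡ δ P u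
  δ-in u = ≡.trans (sum-cong-≗ same) (≡.sym (length-filter-tabulate (λ v → 0# <? P u v) (λ v → v)))
    where
    same : ∀ v → indicator (0# <? P v u) ≡ indicator (0# <? P u v)
    same v with 0# <? P u v
    ... | yes 0<Puv = indicator-yes (0# <? P v u) (P-symmetric-support 0<Puv)
    ... | no ¬0<Puv = indicator-no (0# <? P v u) (¬0<Puv ∘ P-symmetric-support)

  -- Injection and propagation of the rounding errors.

  module _ (σ : Router (suc n)) (srt : IsSRT P σ) (χ₀ : Fin (suc n) → ℕ) where
    open IsSRT srt

    -- Measured against the actual load of `v`, not the expected one, so that it records the
    -- rounding of a single step and no inherited error.
    defect : ℕ → Fin (suc n) → Fin (suc n) → Carrier
    defect t v u = fromℕ (Z σ χ₀ t v u) - fromℕ (χ σ χ₀ t v) * P v u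

    injected : ℕ → Vector (suc n)
    injected t u = sum λ v → defect t v u

    error : ℕ → Vector (suc n)
    error t u = fromℕ (χ σ χ₀ t u) - μ P χ₀ t u

    -- Off the support the router never fires and P is 0, so the defect is exactly 0. The indicator
    -- keeps this, making the sum over `v` cost twice a degree instead of twice the number of
    -- vertices.
    ∣defect∣≤2 : ∀ t v u → ∣ defect t v u ∣ ≤ fromℕ 2 * fromℕ (indicator (0# <? P v u))
    ∣defect∣≤2 t v u with 0# <? P v u
    ... | yes _ = begin
      ∣ defect t v u ∣      ≤⟨ interval-discrepancy u (χ-sum σ χ₀ t v) (χ σ χ₀ t v) ⟩
      fromℕ 2               ≈⟨ *-identityʳ _ ⟨
      fromℕ 2 * 1#          ≈⟨ *-congˡ (+-identityʳ 1#) ⟨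
      fromℕ 2 * fromℕ 1     ∎
      where open SRTDiscrepancy ℝ P stochastic σ srt v
    ... | no ¬0<P = begin
      ∣ defect t v u ∣      ≈⟨ ∣∣-cong defect≈0 ⟩
      ∣ 0# ∣                ≈⟨ 0≤x⇒∣x∣≈x ≤-refl ⟩
      0#                    ≈⟨ zeroʳ _ ⟨
      fromℕ 2 * fromℕ 0     ∎
      where
      open RouterCounts ℝ σ v

      P≈0 : P v u ≈ 0#
      P≈0 = antisym (≮⇒≥ ¬0<P) (proj₁ (stochastic v) u)

      never : ∀ j → σ v j ≢ u
      never j ≡.refl = ¬0<P (functional v j)

      defect≈0 : defect t v u ≈ 0#
      defect≈0 = begin-equality
        fromℕ (Z σ χ₀ t v u) - fromℕ (χ σ χ₀ t v) * P v u
          ≈⟨ +-cong (reflexive (≡.cong fromℕ (I-never u never (χ-sum σ χ₀ t v) (χ σ χ₀ t v)))) (-‿cong (*-congˡ P≈0)) ⟩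
        0# - fromℕ (χ σ χ₀ t v) * 0#
          ≈⟨ solve 1 (λ x → con (ℤ.+ 0) :- x :* con (ℤ.+ 0) := con (ℤ.+ 0)) refl _ ⟩
        0#  ∎

    ∣injected∣≤2Δ : ∀ t u → ∣ injected t u ∣ ≤ fromℕ 2 * fromℕ (maxDegree P)
    ∣injected∣≤2Δ t u = begin
      ∣ injected t u ∣                                              ≤⟨ ∣sum∣≤sum-∣∣ (λ v → defect t v u) ⟩
      sum (λ v → ∣ defect t v u ∣)                                  ≤⟨ sum-mono-≤ (λ v → ∣defect∣≤2 t v u) ⟩
      sum (λ v → fromℕ 2 * fromℕ (indicator (0# <? P v u)))         ≈⟨ *-distribˡ-sum (fromℕ 2) (λ v → fromℕ (indicator (0# <? P v u))) ⟨
      fromℕ 2 * sum (λ v → fromℕ (indicator (0# <? P v u)))         ≈⟨ *-congˡ (fromℕ-sum (λ v → indicator (0# <? P v u))) ⟨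
      fromℕ 2 * fromℕ (sumℕ (λ v → indicator (0# <? P v u)))        ≡⟨ ≡.cong (λ k → fromℕ 2 * fromℕ k) (δ-in u) ⟩
      fromℕ 2 * fromℕ (δ P u)                                       ≤⟨ *-monoˡ-≤ (fromℕ-nonNegative 2) (fromℕ-mono-≤ (δ≤maxDegree u)) ⟩
      fromℕ 2 * fromℕ (maxDegree P)                                 ∎

    -- Tokens are conserved: all χ_v of them leave v.
    sum-injected : ∀ t → sum (injected t) ≈ 0#
    sum-injected t = begin-equality
      sum (λ u → sum (λ v → defect t v u))     ≈⟨ ∑-comm (λ u v → defect t v u) ⟩
      sum (λ v → sum (defect t v))             ≈⟨ sum-cong-≋ balanced ⟩
      sum {suc n} (λ v → 0#)                   ≈⟨ sum-replicate-zero (suc n) ⟩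
      0#                                       ∎
      where
      balanced : ∀ v → sum (defect t v) ≈ 0#
      balanced v = begin-equality
        sum (defect t v)                                                  ≈⟨ sum-distrib-- (fromℕ ∘ Z σ χ₀ t v) (λ u → x * P v u) ⟩
        sum (fromℕ ∘ Z σ χ₀ t v) - sum (λ u → x * P v u)                  ≈⟨ +-cong (fromℕ-sum (Z σ χ₀ t v)) (-‿cong (*-distribˡ-sum x (P v))) ⟨
        fromℕ (sumℕ (Z σ χ₀ t v)) - x * sum (P v)                         ≈⟨ +-cong (reflexive (≡.cong fromℕ (sum-I (χ-sum σ χ₀ t v) (χ σ χ₀ t v))))
                                                                               (-‿cong (trans (*-congˡ (proj₂ (stochastic v))) (*-identityʳ x))) ⟩
        x - x                                                             ≈⟨ solve 1 (λ x → x :- x := con (ℤ.+ 0)) refl x ⟩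
        0#                                                                ∎
        where
        open RouterCounts ℝ σ v
        x : Carrier
        x = fromℕ (χ σ χ₀ t v)

    error-zero : ∀ u → error 0 u ≈ 0#
    error-zero u = begin-equality
      fromℕ (χ₀ u) - μ P χ₀ 0 u       ≈⟨ +-congˡ (-‿cong (⊙-identityʳ (fromℕ ∘ χ₀) u)) ⟩
      fromℕ (χ₀ u) - fromℕ (χ₀ u)     ≈⟨ solve 1 (λ x → x :- x := con (ℤ.+ 0)) refl _ ⟩
      0#                              ∎

    error-suc : ∀ t u → error (suc t) u ≈ (error t ⊙ P) u + injected t u
    error-suc t u = begin-equality
      fromℕ (sumℕ (λ v → Z σ χ₀ t v u)) - μ P χ₀ (suc t) u
        ≈⟨ +-cong (fromℕ-sum (λ v → Z σ χ₀ t v u)) (-‿cong (⊙-assoc (fromℕ ∘ χ₀) (P ^ t) P u)) ⟩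
      sum (λ v → fromℕ (Z σ χ₀ t v u)) - (μ P χ₀ t ⊙ P) u
        ≈⟨ sum-distrib-- (λ v → fromℕ (Z σ χ₀ t v u)) (λ v → μ P χ₀ t v * P v u) ⟨
      sum (λ v → fromℕ (Z σ χ₀ t v u) - μ P χ₀ t v * P v u)
        -- Adding and subtracting χ_v P_{v,u} separates the inherited error from the new rounding
        -- error.
        ≈⟨ sum-cong-≋ (λ v → solve 4 (λ z m x p → z :- m :* p := (x :- m) :* p :+ (z :- x :* p)) refl
             (fromℕ (Z σ χ₀ t v u)) (μ P χ₀ t v) (fromℕ (χ σ χ₀ t v)) (P v u)) ⟩
      sum (λ v → error t v * P v u + defect t v u)
        ≈⟨ ∑-distrib-+ (λ v → error t v * P v u) (λ v → defect t v u) ⟩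
      (error t ⊙ P) u + injected t u
        ∎

    module _ (w : Fin (suc n)) where

      κ : Carrier
      κ = fromℕ 2 * fromℕ (maxDegree P) * (π w / minimum π)

      ∣injected⊙P^k∣≤ : ∀ t k → ∣ (injected t ⊙ P ^ k) w ∣ ≤ κ * distance w k
      ∣injected⊙P^k∣≤ t k = begin
        ∣ (injected t ⊙ P ^ k) w ∣
          ≈⟨ ∣∣-cong (⊙-centre (injected t) (sum-injected t) (P ^ k) w (π w)) ⟩
        ∣ sum (λ u → injected t u * ((P ^ k) u w - π w)) ∣
          ≤⟨ ∣sum∣≤sum-∣∣ (λ u → injected t u * ((P ^ k) u w - π w)) ⟩
        sum (λ u → ∣ injected t u * ((P ^ k) u w - π w) ∣)
          ≤⟨ sum-mono-≤ termwise ⟩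
        sum (λ u → κ * ∣ (P ^ k) w u - π u ∣)
          ≈⟨ *-distribˡ-sum κ (λ u → ∣ (P ^ k) w u - π u ∣) ⟨
        κ * distance w k
          ∎
        where
        termwise : ∀ u → ∣ injected t u * ((P ^ k) u w - π w) ∣ ≤ κ * ∣ (P ^ k) w u - π u ∣
        termwise u = begin
          ∣ injected t u * ((P ^ k) u w - π w) ∣
            ≤⟨ ∣x*y∣≤∣x∣*∣y∣ (injected t u) ((P ^ k) u w - π w) ⟩
          ∣ injected t u ∣ * ∣ (P ^ k) u w - π w ∣
            ≤⟨ *-monoʳ-≤ (∣∣-nonNegative ((P ^ k) u w - π w)) (∣injected∣≤2Δ t u) ⟩
          fromℕ 2 * fromℕ (maxDegree P) * ∣ (P ^ k) u w - π w ∣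
            ≤⟨ *-monoˡ-≤ (*-nonNegative (fromℕ-nonNegative 2) (fromℕ-nonNegative (maxDegree P))) (reverse-deviation w k u) ⟩
          fromℕ 2 * fromℕ (maxDegree P) * (π w / minimum π * ∣ (P ^ k) w u - π u ∣)
            ≈⟨ *-assoc _ _ _ ⟨
          κ * ∣ (P ^ k) w u - π u ∣
            ∎

      -- The exponent `k` is general because each unrolled step hands one more factor `P` to the
      -- remaining error. The summation index is the age of an injection, the newest having age 0,
      -- not its time.
      ∣error⊙P^k∣≤ : ∀ T k → ∣ (error T ⊙ P ^ k) w ∣ ≤ ∑< T (λ t → κ * distance w (t ℕ.+ k))
      ∣error⊙P^k∣≤ zero k = ≤-reflexive (begin-equality
        ∣ (error 0 ⊙ P ^ k) w ∣
          ≈⟨ ∣∣-cong (sum-cong-≋ (λ u → trans (*-congʳ (error-zero u)) (zeroˡ ((P ^ k) u w)))) ⟩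
        ∣ sum {suc n} (λ u → 0#) ∣   ≈⟨ ∣∣-cong (sum-replicate-zero (suc n)) ⟩
        ∣ 0# ∣                       ≈⟨ 0≤x⇒∣x∣≈x ≤-refl ⟩
        0#                           ∎)
      ∣error⊙P^k∣≤ (suc T) k = begin
        ∣ (error (suc T) ⊙ P ^ k) w ∣
          ≈⟨ ∣∣-cong step ⟩
        ∣ (injected T ⊙ P ^ k) w + (error T ⊙ P ^ suc k) w ∣
          ≤⟨ ∣x+y∣≤∣x∣+∣y∣ _ _ ⟩
        ∣ (injected T ⊙ P ^ k) w ∣ + ∣ (error T ⊙ P ^ suc k) w ∣
          ≤⟨ +-mono-≤ (∣injected⊙P^k∣≤ T k) (∣error⊙P^k∣≤ T (suc k)) ⟩
        κ * distance w k + ∑< T (λ t → κ * distance w (t ℕ.+ suc k))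
          ≈⟨ +-congˡ (∑<-cong T (λ t → reflexive (≡.cong (λ j → κ * distance w j) (ℕ.+-suc t k)))) ⟩
        ∑< (suc T) (λ t → κ * distance w (t ℕ.+ k))
          ∎
        where
        step : (error (suc T) ⊙ P ^ k) w ≈ (injected T ⊙ P ^ k) w + (error T ⊙ P ^ suc k) w
        step = begin-equality
          (error (suc T) ⊙ P ^ k) w                               ≈⟨ ⊙-congˡ (P ^ k) (error-suc T) w ⟩
          ((λ u → (error T ⊙ P) u + injected T u) ⊙ P ^ k) w      ≈⟨ ⊙-distrib-+ (error T ⊙ P) (injected T) (P ^ k) w ⟩
          (error T ⊙ P ⊙ P ^ k) w + (injected T ⊙ P ^ k) w        ≈⟨ +-comm _ _ ⟩
          (injected T ⊙ P ^ k) w + (error T ⊙ P ⊙ P ^ k) w        ≈⟨ +-congˡ (⊙-^-suc (error T) P k w) ⟩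
          (injected T ⊙ P ^ k) w + (error T ⊙ P ^ suc k) w        ∎

theorem3p2 : ∀ {c ℓ₁ ℓ₂} (ℝ : CompleteOrderedField c ℓ₁ ℓ₂) →
    let open CompleteOrderedField ℝ
        open Chains ℝ in
    ∀ (n : ℕ) (P : Matrix (suc n)) (π : Vector (suc n)) (t* : ℕ) →
    IsErgodic P →
    IsStationary P π →
    IsReversible P π →
    IsMixingRate P π t* →
    ∀ (σ : Router (suc n)) → IsSRT P σ →
    ∀ (χ₀ : Fin (suc n) → ℕ) (w : Fin (suc n)) (T : ℕ) →
    ∣ fromℕ (χ σ χ₀ T w) - μ P χ₀ T w ∣
      ≤ (fromℕ 6 * π w) / minimum π * fromℕ t* * fromℕ (maxDegree P)
theorem3p2 ℝ n P π t* ergodic stationary reversible mixing σ srt χ₀ w T = begin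
  ∣ error σ srt χ₀ T w ∣
    ≈⟨ ∣∣-cong (⊙-identityʳ (error σ srt χ₀ T) w) ⟨
  ∣ (error σ srt χ₀ T ⊙ P ^ 0) w ∣
    ≤⟨ ∣error⊙P^k∣≤ σ srt χ₀ w T 0 ⟩
  ∑< T (λ t → κ′ * distance w (t ℕ.+ 0))
    ≈⟨ ∑<-cong T (λ t → reflexive (≡.cong (λ j → κ′ * distance w j) (ℕ.+-identityʳ t))) ⟩
  ∑< T (λ t → κ′ * distance w t)
    ≈⟨ ∑<-* T κ′ (distance w) ⟩
  κ′ * ∑< T (distance w)
    ≤⟨ *-monoˡ-≤ 0≤κ (sum-distance t* mixing w T) ⟩
  κ′ * (fromℕ 3 * fromℕ t*)
    -- The 6 is 2 · 3: the 2 is the discrepancy of a window of visits, the 3 comes from summing the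
    -- distances.
    ≈⟨ solve 4 (λ Δ p i t → con (ℤ.+ 2) :* Δ :* (p :* i) :* (con (ℤ.+ 3) :* t) := con (ℤ.+ 6) :* p :* i :* t :* Δ)
         refl (fromℕ (maxDegree P)) (π w) (minimum π ⁻¹) (fromℕ t*) ⟩
  (fromℕ 6 * π w) / minimum π * fromℕ t* * fromℕ (maxDegree P)
    ∎
  where
  open CompleteOrderedField ℝ
  open Chains ℝ
  open FieldProperties ℝ
  open MatrixProperties ℝ
  open RangeSums ℝ
  open ReversibleChain ℝ P π ergodic stationary reversible
  open ≤-Reasoning poset

  κ′ : Carrier
  κ′ = κ σ srt χ₀ w

  0≤κ : 0# ≤ κ′
  0≤κ = *-nonNegative (*-nonNegative (fromℕ-nonNegative 2) (fromℕ-nonNegative (maxDegree P)))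
    (*-nonNegative (π-nonNegative w) (⁻¹-nonNegative minimum-positive))
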